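{- Let $G=(V,E)$ be a graph with $n=|V|$ and $m=|E|$, and let $\sigma$ be an ordering of $V$. Let $\pi^{*}(\sigma)$ be the total ordering of $E$ given by the $\star$ rule: for distinct edges $e_i=ab$ and $e_j=uv$, written so that $a\prec_\sigma b$ and $u\prec_\sigma v$, the edge $e_i$ precedes $e_j$ in $\pi^{*}(\sigma)$ if and only if either $a\prec_\sigma u$, or $a=u$ and $b\prec_\sigma v$. Then $\pi^{*}(\sigma)$ can be constructed (from $G$ and $\sigma$) in $\mathcal{O}(m+n)$ time.
   Context: All graphs are finite and simple, and given by adjacency lists. An ordering of $V$ is a bijection $\sigma:V\to\{1,\dots,n\}$, and $u\prec_\sigma v$ means $\sigma(u)<\sigma(v)$. Running time is measured in the standard RAM model. -}

module Defs where

open import Data.Bool using (if_then_else_)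
open import Data.Fin as Fin using (Fin; toℕ)
import Data.Fin.Properties as Fin
open import Data.Fin.Permutation using (Permutation′; _⟨$⟩ʳ_)
open import Data.List using (List; []; _∷_; _++_; _∷ʳ_; map; concatMap; filter; tabulate; allFin; length; head; drop)
open import Data.List.Membership.Propositional using (_∈_; _∉_)
open import Data.List.Relation.Unary.Unique.Propositional using (Unique)
open import Data.Maybe using (just)
open import Data.Nat using (ℕ; suc; _+_; _∸_; _^_; _<_; _≡ᵇ_)
open import Data.Product using (_×_; _,_; proj₁; proj₂; ∃-syntax)
open import Data.Sum using (_⊎_)
open import Function.Bundles using (_⇔_)
open import Function.Definitions using (Bijective)
open import Relation.Binary.PropositionalEquality using (_≡_)

-- The adjacency lists may list the neighbours in any order.

record Graph : Set where
  field
    n         : ℕ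
    adj       : Fin n → List (Fin n)
    adj-uniq  : ∀ v → Unique (adj v)
    adj-irr   : ∀ v → v ∉ adj v
    adj-sym   : ∀ {u v} → v ∈ adj u → u ∈ adj v

  V : Set
  V = Fin n

  -- The pairs (u , v) with uv ∈ E and u < v as labels: one pair for each
  -- edge, so that m = |E|.
  edgeList : List (V × V)
  edgeList = filter (λ e → proj₁ e Fin.<? proj₂ e)
                    (concatMap (λ u → map (u ,_) (adj u)) (allFin n))

  m : ℕ
  m = length edgeList

open Graph public using (n; m; V; adj)

-- An edge, written with its two ends in one of the two possible orders.
-- Edges are undirected: they are always compared by _≈ᴱ_, never by _≡_.

record Edge (G : Graph) : Set where
  constructor edge
  field
    end₁ end₂ : V G
    adjacent  : end₂ ∈ adj G end₁

open Edge public

_IsEdge_—_ : ∀ {G} → Edge G → V G → V G → Set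
e IsEdge a — b = (end₁ e ≡ a × end₂ e ≡ b) ⊎ (end₁ e ≡ b × end₂ e ≡ a)

_≈ᴱ_ : ∀ {G} → Edge G → Edge G → Set
e ≈ᴱ f = e IsEdge end₁ f — end₂ f

-- Positions are 0, …, n-1 rather than 1, …, n.

Ordering : Graph → Set
Ordering G = Permutation′ (n G)

Before : (G : Graph) → Ordering G → V G → V G → Set
Before G σ u v = (σ ⟨$⟩ʳ u) Fin.< (σ ⟨$⟩ʳ v)

syntax Before G σ u v = u ≺[ G , σ ] v

StarPrecedes : (G : Graph) → Ordering G → Edge G → Edge G → Set
StarPrecedes G σ e f =
  ∃[ a ] ∃[ b ] ∃[ u ] ∃[ v ]
    (e IsEdge a — b) × (a ≺[ G , σ ] b) ×
    (f IsEdge u — v) × (u ≺[ G , σ ] v) ×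
    ((a ≺[ G , σ ] u) ⊎ (a ≡ u × b ≺[ G , σ ] v))

-- π lists every edge exactly once, in the order π*(σ).

record IsStarOrder (G : Graph) (σ : Ordering G) (π : Fin (m G) → Edge G) : Set where
  field
    bijective : Bijective _≡_ _≈ᴱ_ π
    ordered   : ∀ i j → (i Fin.< j) ⇔ StarPrecedes G σ (π i) (π j)

-- The unit-cost RAM of Cook and Reckhow with a read-only input tape and a
-- write-only output tape, except that words are natural numbers (with
-- truncated subtraction), and directly addressed registers are kept apart
-- from the indirectly addressed memory.  A program is finite and so uses
-- only finitely many registers.

data Instr : Set where
  const  : (i c : ℕ) → Instr     -- Rᵢ ← c
  add    : (i j k : ℕ) → Instr   -- Rᵢ ← Rⱼ + Rₖ
  sub    : (i j k : ℕ) → Instr   -- Rᵢ ← Rⱼ ∸ Rₖ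
  load   : (i j : ℕ) → Instr     -- Rᵢ ← M[Rⱼ]
  store  : (i j : ℕ) → Instr     -- M[Rᵢ] ← Rⱼ
  jumpZ  : (i l : ℕ) → Instr     -- if Rᵢ = 0 go to l
  read   : (i : ℕ) → Instr       -- Rᵢ ← next input word
  print  : (i : ℕ) → Instr       -- append Rᵢ to the output
  halt   : Instr

Program : Set
Program = List Instr

record State : Set where
  constructor ⟨_,_,_,_,_⟩
  field
    pc     : ℕ
    reg    : ℕ → ℕ
    mem    : ℕ → ℕ
    input  : List ℕ
    output : List ℕ

open State public

_[_≔_] : (ℕ → ℕ) → ℕ → ℕ → (ℕ → ℕ)
(f [ i ≔ x ]) j = if j ≡ᵇ i then x else f j

_at_is_ : Program → ℕ → Instr → Set
P at p is ι = head (drop p P) ≡ just ι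

-- One step of P on a machine whose words hold the values 0, …, W-1.  The
-- premises x < W guard the only instructions that can bring a new value
-- into the machine; without such a bound, unit-cost addition could
-- operate on words of unrealistic length.  A machine that violates the
-- bound, reads past the end of its input or leaves its program is stuck.

data Step (P : Program) (W : ℕ) : State → State → Set where

  const : ∀ {p r μ xs ys i c} → P at p is const i c → c < W →
          Step P W ⟨ p , r , μ , xs , ys ⟩ ⟨ suc p , r [ i ≔ c ] , μ , xs , ys ⟩

  add   : ∀ {p r μ xs ys i j k} → P at p is add i j k → r j + r k < W →
          Step P W ⟨ p , r , μ , xs , ys ⟩ ⟨ suc p , r [ i ≔ r j + r k ] , μ , xs , ys ⟩

  sub   : ∀ {p r μ xs ys i j k} → P at p is sub i j k →
          Step P W ⟨ p , r , μ , xs , ys ⟩ ⟨ suc p , r [ i ≔ r j ∸ r k ] , μ , xs , ys ⟩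

  load  : ∀ {p r μ xs ys i j} → P at p is load i j →
          Step P W ⟨ p , r , μ , xs , ys ⟩ ⟨ suc p , r [ i ≔ μ (r j) ] , μ , xs , ys ⟩

  store : ∀ {p r μ xs ys i j} → P at p is store i j →
          Step P W ⟨ p , r , μ , xs , ys ⟩ ⟨ suc p , r , μ [ r i ≔ r j ] , xs , ys ⟩

  jump₀ : ∀ {p r μ xs ys i l} → P at p is jumpZ i l → r i ≡ 0 →
          Step P W ⟨ p , r , μ , xs , ys ⟩ ⟨ l , r , μ , xs , ys ⟩

  jump₊ : ∀ {p r μ xs ys i l} → P at p is jumpZ i l → 0 < r i →
          Step P W ⟨ p , r , μ , xs , ys ⟩ ⟨ suc p , r , μ , xs , ys ⟩

  read  : ∀ {p r μ x xs ys i} → P at p is read i → x < W →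
          Step P W ⟨ p , r , μ , x ∷ xs , ys ⟩ ⟨ suc p , r [ i ≔ x ] , μ , xs , ys ⟩

  print : ∀ {p r μ xs ys i} → P at p is print i →
          Step P W ⟨ p , r , μ , xs , ys ⟩ ⟨ suc p , r , μ , xs , ys ∷ʳ r i ⟩

data Steps (P : Program) (W : ℕ) : ℕ → State → State → Set where
  done : ∀ {s} → Steps P W 0 s s
  _∷_  : ∀ {t s s′ s″} → Step P W s s′ → Steps P W t s′ s″ → Steps P W (suc t) s s″

initial : List ℕ → State
initial xs = ⟨ 0 , (λ _ → 0) , (λ _ → 0) , xs , [] ⟩

HaltsWith : Program → (W : ℕ) → (xs : List ℕ) → (t : ℕ) → (ys : List ℕ) → Set
HaltsWith P W xs t ys =
  ∃[ s ] Steps P W t (initial xs) s × (P at pc s is halt) × (output s ≡ ys)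

-- (n+m+2)ᵏ, that is, words of O(log (n+m)) bits.

wordBound : ℕ → Graph → ℕ
wordBound k G = (n G + m G + 2) ^ k

-- n, then σ(v) for each vertex v, then for each vertex v its degree
-- followed by its adjacency list.

encodeInput : (G : Graph) → Ordering G → List ℕ
encodeInput G σ =
  n G ∷ tabulate (λ v → toℕ (σ ⟨$⟩ʳ v))
     ++ concatMap (λ v → length (adj G v) ∷ map toℕ (adj G v)) (allFin (n G))

encodeEdges : ∀ {G k} → (Fin k → Edge G) → List ℕ
encodeEdges π = concatMap (λ e → toℕ (end₁ e) ∷ toℕ (end₂ e) ∷ []) (tabulate π)

{-# OPTIONS --safe #-}
module Submission where

-- A radix sort with linked lists as buckets.  While the adjacency lists are read,
-- each neighbour u ≺ v of v is pushed onto a list belonging to v.  Then the vertices v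
-- are visited in decreasing position, and v is pushed onto a list belonging to u for
-- every u in the list of v; as pushing reverses, that list ends up increasing.
-- Printing the second lists with u in increasing position gives the ⋆ order.

open import Data.Bool using (true; false)
open import Data.Empty using (⊥)
open import Data.Fin as Fin using (Fin; toℕ; opposite; #_)
open import Data.Fin.Permutation using (_⟨$⟩ʳ_; _⟨$⟩ˡ_; inverseˡ; inverseʳ)
import Data.Fin.Properties as Fin
open import Data.List using (List; []; _∷_; _++_; _∷ʳ_; _ʳ++_; map; concatMap; filter;
  length; reverse; tabulate; allFin; lookup)
open import Data.List.Membership.Propositional using (_∈_; find; lose)
open import Data.List.Membership.Propositional.Properties
open import Data.List.Membership.Propositional.Properties.WithK using (unique∧set⇒bag)
import Data.List.Properties as List
open import Data.List.Relation.Binary.BagAndSetEquality using (∼bag⇒↭)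
open import Data.List.Relation.Binary.Permutation.Propositional using (_↭_)
open import Data.List.Relation.Binary.Permutation.Propositional.Properties
  using (↭-length; filter-↭)
open import Data.List.Relation.Unary.All as All using ([]; _∷_)
open import Data.List.Relation.Unary.AllPairs as AllPairs using (AllPairs; []; _∷_)
import Data.List.Relation.Unary.AllPairs.Properties as AllPairs
open import Data.List.Relation.Unary.Any as Any using (here; there)
import Data.List.Relation.Unary.Any.Properties as Any
open import Data.List.Relation.Unary.Unique.Propositional using (Unique)
import Data.List.Relation.Unary.Unique.Propositional.Properties as Unique
open import Data.Nat using (ℕ; zero; suc; _+_; _*_; _∸_; _^_; _≤_; _<_; _≡ᵇ_;
  z≤n; s≤s; z<s; s<s⁻¹)
open import Data.Nat.DivMod using (_%_; [m+kn]%n≡m%n; m<n⇒m%n≡m)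
open import Data.Nat.Properties
open import Data.Nat.Tactic.RingSolver using (solve-∀)
open import Data.Product using (_×_; _,_; proj₁; proj₂; ∃-syntax; swap)
open import Data.Sum using (_⊎_; inj₁; inj₂)
open import Data.Unit using (⊤; tt)
open import Data.Vec as Vec using (Vec; _∷_; []; _[_]≔_)
import Data.Vec.Properties as Vec
open import Function using (_∘_; flip; mk⇔)
open import Function.Bundles using (_⇔_)
open import Function.Definitions using (Bijective)
open import Relation.Binary using (tri<; tri≈; tri>)
open import Relation.Binary.PropositionalEquality
open import Relation.Nullary using (¬_; yes; no; contradiction)
open import Relation.Unary using (Decidable)

open import Defs

-- Only the second pass decides the order. Within the list of `v` the lower ends may come in any
-- order, but they must be distinct: two pairs with the same lower end then come from different `v`,
-- and the decreasing visits settle their order.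
--
-- The time bound is amortised: there are 2m adjacency entries, and each of the two other nested
-- loops makes one inner iteration per edge. Since `m` counts edges by vertex label whereas the
-- program orients them by σ, the two counts are compared through the arcs, of which either
-- orientation selects half.
--
-- The order is established for pure lists only. The pushes onto a family of linked lists form a
-- history, latest first, and the linked lists are its buckets. In both passes the loop invariant
-- links machine and lists by one equation: the pushes still due, reversed onto the history so far,
-- give the final history. A push preserves it by computation.
--
-- Values and addresses must also stay below the word bound, which is why the invariants track the
-- number of allocated nodes.

≡ᵇ-refl : ∀ i → (i ≡ᵇ i) ≡ true
≡ᵇ-refl zero    = refl
≡ᵇ-refl (suc i) = ≡ᵇ-refl i

≢⇒≡ᵇ-false : ∀ {i j} → i ≢ j → (i ≡ᵇ j) ≡ false
≢⇒≡ᵇ-false {zero}  {zero}  i≢j = contradiction refl i≢j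
≢⇒≡ᵇ-false {zero}  {suc j} i≢j = refl
≢⇒≡ᵇ-false {suc i} {zero}  i≢j = refl
≢⇒≡ᵇ-false {suc i} {suc j} i≢j = ≢⇒≡ᵇ-false (i≢j ∘ cong suc)

update-same : ∀ (f : ℕ → ℕ) i {x} → (f [ i ≔ x ]) i ≡ x
update-same f i rewrite ≡ᵇ-refl i = refl

update-other : ∀ (f : ℕ → ℕ) {i j x} → j ≢ i → (f [ i ≔ x ]) j ≡ f j
update-other f j≢i rewrite ≢⇒≡ᵇ-false j≢i = refl

-- A structured language on a few variables and six arrays

Var Array : Set
Var   = Fin 11
Array = Fin 6

data Op : Set where
  const     : Var → ℕ → Op
  add sub   : Var → Var → Var → Op
  get       : Var → Array → Var → Op
  put       : Array → Var → Var → Op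
  read prnt : Var → Op

data Code : Set where
  exec  : List Op → Code
  _⨾_   : Code → Code → Code
  ifPos : Var → Code → Code
  while : Var → Code → Code

infixr 5 _⨾_

record Store : Set where
  constructor store
  field
    vars   : Vec ℕ 11
    arrays : Vec (ℕ → ℕ) 6
    inp    : List ℕ
    out    : List ℕ

open Store

-- Reading exhausted input has a default result here; `Safe` rules this case out, since the machine
-- would be stuck.
apply : Op → Store → Store
apply (const x c) (store R A is os) = store (R [ x ]≔ c) A is os
apply (add x y z) (store R A is os) = store (R [ x ]≔ (Vec.lookup R y + Vec.lookup R z)) A is os
apply (sub x y z) (store R A is os) = store (R [ x ]≔ (Vec.lookup R y ∸ Vec.lookup R z)) A is os
apply (get x a y) (store R A is os) = store (R [ x ]≔ Vec.lookup A a (Vec.lookup R y)) A is os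
apply (put a x y) (store R A is os) =
  store R (A [ a ]≔ (Vec.lookup A a [ Vec.lookup R x ≔ Vec.lookup R y ])) is os
apply (read x)    (store R A [] os)       = store R A [] os
apply (read x)    (store R A (i ∷ is) os) = store (R [ x ]≔ i) A is os
apply (prnt x)    (store R A is os) = store R A is (os ∷ʳ Vec.lookup R x)

applyAll : List Op → Store → Store
applyAll []       s = s
applyAll (o ∷ os) s = applyAll os (apply o s)

-- The arrays are interleaved: cell a i = 6 i + a, computed by additions alone.
cell : Array → ℕ → ℕ
cell a i = (i + i + i) + (i + i + i) + toℕ a

-- Registers 0 and 1 are left free for address computations and jumps.
register : Var → ℕ
register x = suc (suc (toℕ x))

compileOp : Op → List Instr
compileOp (const x c) = const (register x) c ∷ []
compileOp (add x y z) = add (register x) (register y) (register z) ∷ []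
compileOp (sub x y z) = sub (register x) (register y) (register z) ∷ []
compileOp (get x a y) =
  add 0 (register y) (register y) ∷ add 0 0 (register y) ∷ add 0 0 0 ∷
  const 1 (toℕ a) ∷ add 0 0 1 ∷ load (register x) 0 ∷ []
compileOp (put a x y) =
  add 0 (register x) (register x) ∷ add 0 0 (register x) ∷ add 0 0 0 ∷
  const 1 (toℕ a) ∷ add 0 0 1 ∷ store 0 (register y) ∷ []
compileOp (read x)    = read (register x) ∷ []
compileOp (prnt x)    = print (register x) ∷ []

size : Code → ℕ
size (exec os)   = length (concatMap compileOp os)
size (C ⨾ D)     = size C + size D
size (ifPos x C) = suc (size C)
size (while x C) = 3 + size C

-- The address `l` at which the code will lie is a parameter because jump targets are absolute. The
-- unconditional jump back to a loop test is a `jumpZ` on register 0 just after clearing it.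
compile : ℕ → Code → List Instr
compile l (exec os)   = concatMap compileOp os
compile l (C ⨾ D)     = compile l C ++ compile (size C + l) D
compile l (ifPos x C) = jumpZ (register x) (size C + suc l) ∷ compile (suc l) C
compile l (while x C) =
  jumpZ (register x) (3 + size C + l) ∷ compile (suc l) C ++ const 0 0 ∷ jumpZ 0 l ∷ []

length-compile : ∀ l C → length (compile l C) ≡ size C
length-compile l (exec os)   = refl
length-compile l (C ⨾ D)     = trans (List.length-++ (compile l C))
  (cong₂ _+_ (length-compile l C) (length-compile (size C + l) D))
length-compile l (ifPos x C) = cong suc (length-compile (suc l) C)
length-compile l (while x C) = cong suc (trans (List.length-++ (compile (suc l) C))
  (trans (cong (_+ 2) (length-compile (suc l) C)) (+-comm (size C) 2)))

Holds : Program → ℕ → List Instr → Set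
Holds P l []       = ⊤
Holds P l (ι ∷ ιs) = P at l is ι × Holds P (suc l) ιs

Holds-++⁻ : ∀ {P l} ιs {κs} → Holds P l (ιs ++ κs) → Holds P l ιs × Holds P (length ιs + l) κs
Holds-++⁻ []       h = tt , h
Holds-++⁻ {P} {l} (ι ∷ ιs) {κs} (h , hs) with Holds-++⁻ ιs hs
... | hι , hκ = (h , hι) , subst (λ l → Holds P l κs) (+-suc (length ιs) l) hκ

at-length : ∀ pre {ι ιs} → (pre ++ ι ∷ ιs) at length pre is ι
at-length []        = refl
at-length (_ ∷ pre) = at-length pre

Holds-++⁺ : ∀ pre ιs {post} → Holds (pre ++ ιs ++ post) (length pre) ιs
Holds-++⁺ pre []       = tt
Holds-++⁺ pre (ι ∷ ιs) {post} = at-length pre ,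
  subst (λ P → Holds P (suc (length pre)) ιs) (List.∷ʳ-++ pre ι (ιs ++ post))
    (subst (λ l → Holds (pre ∷ʳ ι ++ ιs ++ post) l ιs)
      (trans (List.length-++ pre) (+-comm (length pre) 1))
      (Holds-++⁺ (pre ∷ʳ ι) ιs))

cell≡toℕ+i*6 : ∀ a i → cell a i ≡ toℕ a + i * 6
cell≡toℕ+i*6 a i = arith (toℕ a) i
  where
  arith : ∀ a i → (i + i + i) + (i + i + i) + a ≡ a + i * 6
  arith = solve-∀

-- The array number is the residue of the address modulo 6; cancelling it leaves the multiples of 6.
cell-injective : ∀ {a b i j} → cell a i ≡ cell b j → a ≡ b × i ≡ j
cell-injective {a} {b} {i} {j} eq = a≡b , *-cancelʳ-≡ i j 6 (+-cancelˡ-≡ (toℕ b) _ _ sums)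
  where
  open ≡-Reasoning
  eq′ : toℕ a + i * 6 ≡ toℕ b + j * 6
  eq′ = trans (sym (cell≡toℕ+i*6 a i)) (trans eq (cell≡toℕ+i*6 b j))
  a≡b : a ≡ b
  a≡b = Fin.toℕ-injective (begin
    toℕ a                   ≡⟨ m<n⇒m%n≡m (Fin.toℕ<n a) ⟨
    toℕ a % 6               ≡⟨ [m+kn]%n≡m%n (toℕ a) i 6 ⟨
    (toℕ a + i * 6) % 6     ≡⟨ cong (_% 6) eq′ ⟩
    (toℕ b + j * 6) % 6     ≡⟨ [m+kn]%n≡m%n (toℕ b) j 6 ⟩
    toℕ b % 6               ≡⟨ m<n⇒m%n≡m (Fin.toℕ<n b) ⟩
    toℕ b                   ∎)
  sums : toℕ b + i * 6 ≡ toℕ b + j * 6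
  sums = trans (cong (λ a → toℕ a + i * 6) (sym a≡b)) eq′

-- Simulation by the machine with words below W

-- Nothing is said of registers 0 and 1, so writing to them preserves the relation, and by mere
-- computation, as `register x` is at least 2.
record Represents (r μ : ℕ → ℕ) (R : Vec ℕ 11) (A : Vec (ℕ → ℕ) 6) : Set where
  constructor _∙_
  field
    registers : ∀ x → r (register x) ≡ Vec.lookup R x
    memory    : ∀ a i → μ (cell a i) ≡ Vec.lookup A a i

module _ {r μ : ℕ → ℕ} {R : Vec ℕ 11} {A : Vec (ℕ → ℕ) 6} (rep : Represents r μ R A) where

  open Represents rep renaming (registers to rR; memory to μA)

  represents-assign : ∀ x {w w′} → w ≡ w′ → Represents (r [ register x ≔ w ]) μ (R [ x ]≔ w′) A
  represents-assign x {w} refl = assign ∙ μA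
    where
    assign : ∀ y → (r [ register x ≔ w ]) (register y) ≡ Vec.lookup (R [ x ]≔ w) y
    assign y with y Fin.≟ x
    ... | yes refl = trans (update-same r (register x)) (sym (Vec.lookup∘updateAt x R))
    ... | no y≢x   = trans (update-other r (y≢x ∘ Fin.toℕ-injective ∘ suc-injective ∘ suc-injective))
                           (trans (rR y) (sym (Vec.lookup∘updateAt′ y x y≢x R)))

  represents-put : ∀ a {k i w w′} → k ≡ cell a i → w ≡ w′ →
                   Represents r (μ [ k ≔ w ]) R (A [ a ]≔ (Vec.lookup A a [ i ≔ w′ ]))
  represents-put a {i = i} {w} refl refl = rR ∙ put′
    where
    put′ : ∀ b j → (μ [ cell a i ≔ w ]) (cell b j)
                 ≡ Vec.lookup (A [ a ]≔ (Vec.lookup A a [ i ≔ w ])) b j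
    put′ b j with b Fin.≟ a
    ... | no b≢a = trans (update-other μ (b≢a ∘ proj₁ ∘ cell-injective {b} {a} {j} {i}))
                     (trans (μA b j) (cong (λ f → f j) (sym (Vec.lookup∘updateAt′ b a b≢a A))))
    ... | yes refl with j ≟ i
    ...   | yes refl = trans (update-same μ (cell a i)) (sym (trans
                         (cong (λ f → f i) (Vec.lookup∘updateAt a A))
                         (update-same (Vec.lookup A a) i)))
    ...   | no j≢i   = trans (update-other μ (j≢i ∘ proj₂ ∘ cell-injective {a} {a} {j} {i}))
                         (trans (μA a j) (sym (trans
                           (cong (λ f → f j) (Vec.lookup∘updateAt a A))
                           (update-other (Vec.lookup A a) j≢i))))

module Execution (W : ℕ) where

  Safe : Op → Store → Set
  Safe (const x c) s                    = c < W
  Safe (add x y z) s                    = Vec.lookup (vars s) y + Vec.lookup (vars s) z < W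
  Safe (sub x y z) s                    = ⊤
  Safe (get x a y) s                    = cell a (Vec.lookup (vars s) y) < W
  Safe (put a x y) s                    = cell a (Vec.lookup (vars s) x) < W
  Safe (read x) (store R A [] os)       = ⊥
  Safe (read x) (store R A (i ∷ is) os) = i < W
  Safe (prnt x) s                       = ⊤

  SafeAll : List Op → Store → Set
  SafeAll []       s = ⊤
  SafeAll (o ∷ os) s = Safe o s × SafeAll os (apply o s)

  _++ˢ_ : ∀ {P t t′ s s′ s″} → Steps P W t s s′ → Steps P W t′ s′ s″ → Steps P W (t + t′) s s″
  done     ++ˢ q = q
  (st ∷ p) ++ˢ q = st ∷ (p ++ˢ q)

  infixr 5 _++ˢ_

  retarget : ∀ {P t s l l′ r μ is os} → l ≡ l′ →
             Steps P W t s ⟨ l , r , μ , is , os ⟩ → Steps P W t s ⟨ l′ , r , μ , is , os ⟩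
  retarget refl st = st

  record Reaches (P : Program) (l : ℕ) (r μ : ℕ → ℕ) (is os : List ℕ)
                 (b : ℕ) (l′ : ℕ) (s′ : Store) : Set where
    constructor reaches
    field
      {time}     : ℕ
      {reg′ mem′} : ℕ → ℕ
      time≤      : time ≤ b
      steps      : Steps P W time ⟨ l , r , μ , is , os ⟩ ⟨ l′ , reg′ , mem′ , inp s′ , out s′ ⟩
      represents : Represents reg′ mem′ (vars s′) (arrays s′)

  -- Quantifying over the program, the load address and every representing machine state makes runs
  -- relocatable, so that they compose along `compile`.
  Runs : Code → Store → ℕ → Store → Set
  Runs C s b s′ = ∀ {P l r μ} → Holds P l (compile l C) → Represents r μ (vars s) (arrays s) →
                  Reaches P l r μ (inp s) (out s) b (size C + l) s′

  -- One bound on the finished address suffices: the partial results 2i, 3i and 6i and the array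
  -- number are all at most the final sum.
  address : ∀ {P l r μ R A is os ιs} a x → Represents r μ R A → cell a (Vec.lookup R x) < W →
            Holds P l (add 0 (register x) (register x) ∷ add 0 0 (register x) ∷ add 0 0 0 ∷
                       const 1 (toℕ a) ∷ add 0 0 1 ∷ ιs) →
            ∃[ r′ ] Steps P W 5 ⟨ l , r , μ , is , os ⟩ ⟨ 5 + l , r′ , μ , is , os ⟩
                    × Represents r′ μ R A × (r′ 0 ≡ cell a (Vec.lookup R x)) × Holds P (5 + l) ιs
  address {R = R} a x rep@(rR ∙ μA) bound (h₁ , h₂ , h₃ , h₄ , h₅ , hs) =
    _ , add h₁ (≤-<-trans (m≤m+n _ _) i₃<W) ∷ add h₂ i₃<W ∷ add h₃ i₆<W ∷
        const h₄ (≤-<-trans (m≤n+m _ _) i₇<W) ∷ add h₅ i₇<W ∷ done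
      , rR ∙ μA , cong (λ i → cell a i) (rR x) , hs
    where
    i₇<W = subst (λ i → cell a i < W) (sym (rR x)) bound
    i₆<W = ≤-<-trans (m≤m+n _ _) i₇<W
    i₃<W = ≤-<-trans (m≤m+n _ _) i₆<W

  op-runs : ∀ {P l r μ s} o → Safe o s → Holds P l (compileOp o) →
            Represents r μ (vars s) (arrays s) →
            Reaches P l r μ (inp s) (out s) (length (compileOp o))
                    (length (compileOp o) + l) (apply o s)
  op-runs (const x c) safe (h , _) rep =
    reaches ≤-refl (const h safe ∷ done) (represents-assign rep x refl)
  op-runs (add x y z) safe (h , _) rep@(rR ∙ _) = reaches ≤-refl
    (add h (subst (_< W) (sym (cong₂ _+_ (rR y) (rR z))) safe) ∷ done)
    (represents-assign rep x (cong₂ _+_ (rR y) (rR z)))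
  op-runs (sub x y z) safe (h , _) rep@(rR ∙ _) = reaches ≤-refl (sub h ∷ done)
    (represents-assign rep x (cong₂ _∸_ (rR y) (rR z)))
  op-runs {μ = μ} (get x a y) safe hs rep with address a y rep safe hs
  ... | r′ , steps , rep′@(_ ∙ μA) , r′0 , (h , _) = reaches ≤-refl (steps ++ˢ load h ∷ done)
    (represents-assign rep′ x (trans (cong μ r′0) (μA a _)))
  op-runs (put a x y) safe hs rep with address a x rep safe hs
  ... | r′ , steps , rep′@(rR ∙ _) , r′0 , (h , _) = reaches ≤-refl (steps ++ˢ store h ∷ done)
    (represents-put rep′ a r′0 (rR y))
  op-runs {s = store R A (i ∷ is) os} (read x) safe (h , _) rep = reaches ≤-refl (read h safe ∷ done)
    (represents-assign rep x refl)
  op-runs {P} {l} {r} {μ} {s = store R A is os} (prnt x) safe (h , _) rep@(rR ∙ _) = reaches ≤-refl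
    (subst (λ w → Steps P W 1 _ ⟨ suc l , r , μ , is , os ∷ʳ w ⟩) (rR x) (print h ∷ done)) rep

  runs-exec : ∀ {s} os → SafeAll os s → Runs (exec os) s (size (exec os)) (applyAll os s)
  runs-exec []       _             hs rep = reaches ≤-refl done rep
  runs-exec {s} (o ∷ os) (safe , safes) {P} {l} hs rep with Holds-++⁻ (compileOp o) hs
  ... | h , hs′ with op-runs {s = s} o safe h rep
  ... | reaches t≤ st rep′ with runs-exec os safes hs′ rep′
  ... | reaches t′≤ st′ rep″ rewrite List.length-++ (compileOp o) {concatMap compileOp os}
        = reaches (+-mono-≤ t≤ t′≤)
            (st ++ˢ retarget pc≡ st′) rep″
    where
    pc≡ : length (concatMap compileOp os) + (length (compileOp o) + l)
          ≡ length (compileOp o) + length (concatMap compileOp os) + l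
    pc≡ = trans (sym (+-assoc (length (concatMap compileOp os)) _ l))
                (cong (_+ l) (+-comm (length (concatMap compileOp os)) _))

  -- Proof rules with explicit cost

  record Achieves (C : Code) (s : Store) (b : ℕ) (Q : Store → Set) : Set where
    constructor achieves
    field
      {final} : Store
      runs    : Runs C s b final
      post    : Q final

  module _ {Q : Store → Set} where

    weaken : ∀ {C s b b′} → b ≤ b′ → Achieves C s b Q → Achieves C s b′ Q
    weaken b≤b′ (achieves runs post) = achieves
      (λ h rep → let reaches t≤ st rep′ = runs h rep in reaches (≤-trans t≤ b≤b′) st rep′) post

    exec-rule : ∀ {s} os → SafeAll os s → Q (applyAll os s) → Achieves (exec os) s (size (exec os)) Q
    exec-rule os safe post = achieves (runs-exec os safe) post

    seq-rule : ∀ {C D s b b′} {I : Store → Set} → Achieves C s b I →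
               (∀ {s} → I s → Achieves D s b′ Q) → Achieves (C ⨾ D) s (b + b′) Q
    seq-rule {C} {D} {s} {b} {b′} (achieves {final} runs post) next with next post
    ... | achieves {final′} runs′ post′ = achieves both post′
      where
      both : Runs (C ⨾ D) s (b + b′) final′
      both {P} {l} h rep with Holds-++⁻ (compile l C) h
      ... | hC , hD with runs hC rep
      ... | reaches t≤ st rep′
          with runs′ (subst (λ k → Holds P (k + l) (compile (size C + l) D))
                        (length-compile l C) hD) rep′
      ... | reaches t′≤ st′ rep″ = reaches (+-mono-≤ t≤ t′≤)
        (st ++ˢ retarget
          (trans (sym (+-assoc (size D) _ l)) (cong (_+ l) (+-comm (size D) _))) st′) rep″

    exec-seq-rule : ∀ {D s b} os → SafeAll os s → Achieves D (applyAll os s) b Q →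
                    Achieves (exec os ⨾ D) s (size (exec os) + b) Q
    exec-seq-rule {s = s} os safe d =
      seq-rule {I = _≡ applyAll os s} (achieves (runs-exec os safe) refl) λ { refl → d }

    skip-rule : ∀ {C x s} → Vec.lookup (vars s) x ≡ 0 → Q s → Achieves (ifPos x C) s 1 Q
    skip-rule {C} {x} {s} x≡0 post = achieves skip post
      where
      skip : Runs (ifPos x C) s 1 s
      skip {P} {l} (h , _) rep@(rR ∙ _) = reaches ≤-refl
        (retarget (+-suc (size C) l)
          (jump₀ h (trans (rR x) x≡0) ∷ done)) rep

    then-rule : ∀ {C x s b} → 0 < Vec.lookup (vars s) x → Achieves C s b Q →
                Achieves (ifPos x C) s (1 + b) Q
    then-rule {C} {x} {s} {b} 0<x (achieves {final} runs post) = achieves both post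
      where
      both : Runs (ifPos x C) s (1 + b) final
      both {P} {l} (h , hs) rep@(rR ∙ _) with runs hs rep
      ... | reaches t≤ st rep′ = reaches (s≤s t≤)
        (jump₊ h (subst (0 <_) (sym (rR x)) 0<x) ∷
          retarget (+-suc (size C) l) st) rep′

  -- The 3 steps besides the body are the passed test, the clearing of register 0 and the jump back;
  -- the final 1 is the failing test.
  loopTime : ∀ {A : Set} → (A → ℕ) → List A → ℕ
  loopTime b []       = 1
  loopTime b (a ∷ as) = 3 + b a + loopTime b as

  -- The list is a ghost: it counts the iterations and is not part of the store.
  while-rule : ∀ {A : Set} {C x} (I : List A → Store → Set) (b : A → ℕ) → 0 < W →
               (∀ {s} → I [] s → Vec.lookup (vars s) x ≡ 0) →
               (∀ {a as s} → I (a ∷ as) s → 0 < Vec.lookup (vars s) x) →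
               (∀ {a as s} → I (a ∷ as) s → Achieves C s (b a) (I as)) →
               ∀ as {s} → I as s → Achieves (while x C) s (loopTime b as) (I [])
  while-rule {C = C} {x} I b 0<W stop go body [] {s} i = achieves exit i
    where
    exit : Runs (while x C) s 1 s
    exit (h , _) rep@(rR ∙ _) = reaches ≤-refl (jump₀ h (trans (rR x) (stop i)) ∷ done) rep
  while-rule {C = C} {x} I b 0<W stop go body (a ∷ as) {s} i with body i
  ... | achieves {s₁} runs i′ with while-rule {C = C} {x} I b 0<W stop go body as i′
  ... | achieves {s₂} runs′ i″ = achieves iterate i″
    where
    iterate : Runs (while x C) s (3 + b a + loopTime b as) s₂
    iterate {P} {l} h₀@(h , hs) rep@(rR ∙ _) with Holds-++⁻ (compile (suc l) C) hs
    ... | hC , hJ with runs hC rep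
    ... | reaches {t} {r′} {μ′} t≤ st (rR′ ∙ μA′)
        with subst (λ k → Holds P k (const 0 0 ∷ jumpZ 0 l ∷ []))
               (cong (_+ suc l) (length-compile (suc l) C)) hJ
    ... | h₁ , h₂ , _ with runs′ {r = r′ [ 0 ≔ 0 ]} {μ′} h₀ (rR′ ∙ μA′)
    ... | reaches {t′} t′≤ st′ rep″ = reaches bound
      (jump₊ h (subst (0 <_) (sym (rR x)) (go i)) ∷ st ++ˢ const h₁ 0<W ∷ jump₀ h₂ refl ∷ st′) rep″
      where
      arith : ∀ t t′ → suc (t + (2 + t′)) ≡ 3 + t + t′
      arith = solve-∀
      bound : suc (t + (2 + t′)) ≤ 3 + b a + loopTime b as
      bound = ≤-trans (≤-reflexive (arith t t′)) (+-mono-≤ (s≤s (s≤s (s≤s t≤))) t′≤)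

  -- This is the amortisation: body costs affine in the sizes of the `f a` add up to the total size,
  -- which will be m or 2m.
  loopTime-linear : ∀ {A B : Set} (f : A → List B) k k′ as →
                    loopTime (λ a → k + k′ * length (f a)) as
                    ≡ 1 + (3 + k) * length as + k′ * length (concatMap f as)
  loopTime-linear f k k′ []       = arith k k′
    where
    arith : ∀ k k′ → 1 ≡ 1 + (3 + k) * 0 + k′ * 0
    arith = solve-∀
  loopTime-linear f k k′ (a ∷ as)
    rewrite loopTime-linear f k k′ as | List.length-++ (f a) {concatMap f as}
    = arith k k′ (length (f a)) (length as) (length (concatMap f as))
    where
    arith : ∀ k k′ x y z → 3 + (k + k′ * x) + (1 + (3 + k) * y + k′ * z)
            ≡ 1 + (3 + k) * (1 + y) + k′ * (x + z)
    arith = solve-∀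

  loopTime-constant : ∀ {A : Set} k (as : List A) → loopTime (λ _ → k) as ≡ 1 + (3 + k) * length as
  loopTime-constant k []       = cong suc (sym (*-zeroʳ (3 + k)))
  loopTime-constant k (a ∷ as) rewrite loopTime-constant k as = arith k (length as)
    where
    arith : ∀ k y → 3 + k + (1 + (3 + k) * y) ≡ 1 + (3 + k) * (1 + y)
    arith = solve-∀

  halts-rule : ∀ {C R A is b Q} → (∀ x → 0 ≡ Vec.lookup R x) → (∀ a i → 0 ≡ Vec.lookup A a i) →
    Achieves C (store R A is []) b Q →
    ∃[ s ] ∃[ t ] Q s × t ≤ b × HaltsWith (compile 0 C ++ halt ∷ []) W is t (out s)
  halts-rule {C} R≡0 A≡0 (achieves {s} runs post)
    with runs (Holds-++⁺ [] (compile 0 C)) (R≡0 ∙ A≡0)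
  ... | reaches t≤ steps _ = s , _ , post , t≤ , _ , steps ,
    subst (λ l → (compile 0 C ++ halt ∷ []) at l is halt)
      (trans (length-compile 0 C) (sym (+-identityʳ (size C)))) (at-length (compile 0 C)) , refl

-- Counting, reversing and grouping lists

module _ {A : Set} where

  -- Reduces a comparison of lengths to two membership proofs; the edge counts rest on it.
  unique-sets-↭ : {xs ys : List A} → Unique xs → Unique ys →
                  (∀ {x} → x ∈ xs → x ∈ ys) → (∀ {x} → x ∈ ys → x ∈ xs) → xs ↭ ys
  unique-sets-↭ xs! ys! to from = ∼bag⇒↭ (unique∧set⇒bag xs! ys! (mk⇔ to from))

  length-filter-complement : {P Q : A → Set} (P? : Decidable P) (Q? : Decidable Q) (xs : List A) →
    (∀ {x} → x ∈ xs → P x ⊎ Q x) → (∀ {x} → P x → ¬ Q x) →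
    length (filter P? xs) + length (filter Q? xs) ≡ length xs
  length-filter-complement P? Q? []       cover disjoint = refl
  length-filter-complement P? Q? (x ∷ xs) cover disjoint
    with P? x | Q? x | length-filter-complement P? Q? xs (cover ∘ there) disjoint
  ... | yes p | yes q | _  = contradiction q (disjoint p)
  ... | yes p | no ¬q | eq = cong suc eq
  ... | no ¬p | yes q | eq = trans (+-suc _ _) (cong suc eq)
  ... | no ¬p | no ¬q | _  with cover (here refl)
  ...   | inj₁ p = contradiction p ¬p
  ...   | inj₂ q = contradiction q ¬q

  length-filter-map : {B : Set} {P : B → Set} (P? : Decidable P) (f : A → B) (xs : List A) →
    length (filter P? (map f xs)) ≡ length (filter (P? ∘ f) xs)
  length-filter-map P? f []       = refl
  length-filter-map P? f (x ∷ xs) with P? (f x)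
  ... | yes _ = cong suc (length-filter-map P? f xs)
  ... | no _  = length-filter-map P? f xs

  AllPairs-ʳ++ : {R : A → A → Set} {xs ys : List A} → AllPairs R xs → AllPairs (flip R) ys →
                 (∀ {x y} → x ∈ xs → y ∈ ys → R y x) → AllPairs (flip R) (xs ʳ++ ys)
  AllPairs-ʳ++ []            Rys Rxy = Rys
  AllPairs-ʳ++ (Rx ∷ Rxs) Rys Rxy = AllPairs-ʳ++ Rxs (All.tabulate (Rxy (here refl)) ∷ Rys)
    λ { x∈xs (here refl) → All.lookup Rx x∈xs ; x∈xs (there y∈ys) → Rxy (there x∈xs) y∈ys }

  AllPairs-reverse : {R : A → A → Set} {xs : List A} → AllPairs R xs → AllPairs (flip R) (reverse xs)
  AllPairs-reverse Rxs = AllPairs-ʳ++ Rxs [] (λ _ ())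

  AllPairs-map∈ : {R S : A → A → Set} {xs : List A} →
    (∀ {x y} → x ∈ xs → y ∈ xs → R x y → S x y) → AllPairs R xs → AllPairs S xs
  AllPairs-map∈ f []         = []
  AllPairs-map∈ f (Rx ∷ Rxs) = All.tabulate (λ y∈ → f (here refl) (there y∈) (All.lookup Rx y∈))
    ∷ AllPairs-map∈ (λ x∈ y∈ → f (there x∈) (there y∈)) Rxs

module _ {A B : Set} where

  group : (A → List B) → List A → List (A × B)
  group f = concatMap (λ a → map (a ,_) (f a))

  cogroup : (A → List B) → List A → List (B × A)
  cogroup f = concatMap (λ a → map (_, a) (f a))

  cogroup≡swap-group : ∀ f as → cogroup f as ≡ map swap (group f as)
  cogroup≡swap-group f as = sym (trans (List.map-concatMap swap _ as)
    (List.concatMap-cong (λ a → sym (List.map-∘ (f a))) as))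

  ∈-group⁺ : ∀ {f a b as} → a ∈ as → b ∈ f a → (a , b) ∈ group f as
  ∈-group⁺ {f} {a} a∈as b∈fa = ∈-concatMap⁺ (λ a → map (a ,_) (f a)) (lose a∈as (∈-map⁺ (a ,_) b∈fa))

  ∈-group⁻ : ∀ {f a b} as → (a , b) ∈ group f as → a ∈ as × b ∈ f a
  ∈-group⁻ {f} as ab∈ with find (∈-concatMap⁻ (λ a → map (a ,_) (f a)) {xs = as} ab∈)
  ... | a , a∈as , ab∈′ with ∈-map⁻ (a ,_) ab∈′
  ... | b , b∈fa , refl = a∈as , b∈fa

  length-group : ∀ f as → length (group f as) ≡ length (concatMap f as)
  length-group f []       = refl
  length-group f (a ∷ as) = trans (List.length-++ (map (a ,_) (f a))) (trans
    (cong₂ _+_ (List.length-map (a ,_) (f a)) (length-group f as)) (sym (List.length-++ (f a))))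

  length-cogroup : ∀ f as → length (cogroup f as) ≡ length (concatMap f as)
  length-cogroup f as = trans (cong length (cogroup≡swap-group f as))
    (trans (List.length-map swap (group f as)) (length-group f as))

  AllPairs-group : {R : A × B → A × B → Set} {S : A → A → Set} → ∀ {f as} → AllPairs S as →
    (∀ {a b a′ b′} → S a a′ → R (a , b) (a′ , b′)) →
    (∀ a → AllPairs (λ b b′ → R (a , b) (a , b′)) (f a)) →
    AllPairs R (group f as)
  AllPairs-group                    []         across within = []
  AllPairs-group {R} {f = f} {a ∷ as} (Sa ∷ Sas) across within =
    AllPairs.++⁺ (AllPairs.map⁺ (within a)) (AllPairs-group Sas across within)
      (All.tabulate λ x∈ → All.tabulate λ y∈ → related x∈ y∈)
    where
    related : ∀ {x y} → x ∈ map (a ,_) (f a) → y ∈ group f as → R x y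
    related x∈ y∈ with ∈-map⁻ (a ,_) x∈
    ... | b , _ , refl = across (All.lookup Sa (proj₁ (∈-group⁻ as y∈)))

-- Bucketing by the upper and then by the lower end

module _ {k : ℕ} {B : Set} where

  bucket : List (Fin k × B) → Fin k → List B
  bucket H i = map proj₂ (filter (λ p → proj₁ p Fin.≟ i) H)

  ∈-bucket⁺ : ∀ {H i b} → (i , b) ∈ H → b ∈ bucket H i
  ∈-bucket⁺ {i = i} ib∈H = ∈-map⁺ proj₂ (∈-filter⁺ (λ p → proj₁ p Fin.≟ i) ib∈H refl)

  ∈-bucket⁻ : ∀ {H i b} → b ∈ bucket H i → (i , b) ∈ H
  ∈-bucket⁻ {i = i} b∈ with ∈-map⁻ proj₂ b∈
  ... | (_ , _) , p∈ , refl with ∈-filter⁻ (λ p → proj₁ p Fin.≟ i) p∈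
  ... | p∈H , refl = p∈H

  -- The filter supplies every member with its key equation, so `R` has to be known only between
  -- entries with equal keys.
  AllPairs-bucket : {R : B → B → Set} → ∀ {H} i →
    AllPairs (λ { (j , b) (j′ , b′) → j ≡ j′ → R b b′ }) H → AllPairs R (bucket H i)
  AllPairs-bucket {H = H} i RH = AllPairs.map⁺ (AllPairs-map∈
    (λ x∈ y∈ R′ → R′ (trans (key x∈) (sym (key y∈)))) (AllPairs.filter⁺ (λ p → proj₁ p Fin.≟ i) RH))
    where
    key : ∀ {x} → x ∈ filter (λ p → proj₁ p Fin.≟ i) H → proj₁ x ≡ i
    key = proj₂ ∘ ∈-filter⁻ (λ p → proj₁ p Fin.≟ i) {xs = H}

-- The two-pass sort on pure lists

module Sorting (G : Graph) (σ : Ordering G) where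

  position : V G → V G
  position = σ ⟨$⟩ʳ_

  vertexAt : V G → V G
  vertexAt = σ ⟨$⟩ˡ_

  position-vertexAt : ∀ p → position (vertexAt p) ≡ p
  position-vertexAt p = inverseʳ σ

  position-injective : ∀ {u v} → position u ≡ position v → u ≡ v
  position-injective {u} {v} eq = trans (sym (inverseˡ σ)) (trans (cong vertexAt eq) (inverseˡ σ))

  earlier? : ∀ v → Decidable (λ u → u ≺[ G , σ ] v)
  earlier? v u = position u Fin.<? position v

  earlierNeighbours : V G → List (V G)
  earlierNeighbours v = filter (earlier? v) (adj G v)

  -- The history of pushes made while reading, latest first, so that `bucket` returns each list in
  -- the order in which the linked list is traversed.
  byUpper : List (V G × V G)
  byUpper = reverse (group earlierNeighbours (allFin (n G)))

  lowerEnds : V G → List (V G)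
  lowerEnds = bucket byUpper

  descending ascending : List (V G)
  descending = map vertexAt (tabulate opposite)
  ascending  = map vertexAt (allFin (n G))

  byLower : List (V G × V G)
  byLower = reverse (cogroup lowerEnds descending)

  upperEnds : V G → List (V G)
  upperEnds = bucket byLower

  sortedPairs : List (V G × V G)
  sortedPairs = group upperEnds ascending

  ∈-ascending : ∀ v → v ∈ ascending
  ∈-ascending v = subst (_∈ ascending) (inverseˡ σ) (∈-map⁺ vertexAt (∈-allFin (position v)))

  ∈-descending : ∀ v → v ∈ descending
  ∈-descending v = subst (_∈ descending)
    (trans (cong vertexAt (Fin.opposite-involutive (position v))) (inverseˡ σ))
    (∈-map⁺ vertexAt (∈-tabulate⁺ (opposite (position v))))

  ascending-sorted : AllPairs (λ u v → u ≺[ G , σ ] v) ascending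
  ascending-sorted = AllPairs.map⁺ (AllPairs.tabulate⁺-< λ {i} {j} i<j →
    subst₂ Fin._<_ (sym (position-vertexAt i)) (sym (position-vertexAt j)) i<j)

  opposite-anti : ∀ {k} {i j : Fin k} → i Fin.< j → opposite j Fin.< opposite i
  opposite-anti {k} {i} {j} i<j = subst₂ _<_ (sym (Fin.opposite-prop j)) (sym (Fin.opposite-prop i))
    (∸-monoʳ-< (s≤s i<j) (Fin.toℕ<n j))

  descending-sorted : AllPairs (λ u v → v ≺[ G , σ ] u) descending
  descending-sorted = AllPairs.map⁺ (AllPairs.tabulate⁺-< λ {i} {j} i<j →
    subst₂ Fin._<_ (sym (position-vertexAt (opposite j))) (sym (position-vertexAt (opposite i)))
      (opposite-anti i<j))

  Directed : V G × V G → Set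
  Directed (u , v) = v ∈ adj G u × u ≺[ G , σ ] v

  ∈-lowerEnds⁺ : ∀ {u v} → Directed (u , v) → u ∈ lowerEnds v
  ∈-lowerEnds⁺ {u} {v} (v∈adj , u≺v) = ∈-bucket⁺ (Any.reverse⁺
    (∈-group⁺ (∈-allFin v) (∈-filter⁺ (earlier? v) (Graph.adj-sym G v∈adj) u≺v)))

  ∈-lowerEnds⁻ : ∀ {u v} → u ∈ lowerEnds v → Directed (u , v)
  ∈-lowerEnds⁻ {u} {v} u∈ with ∈-filter⁻ (earlier? v) {xs = adj G v}
    (proj₂ (∈-group⁻ {f = earlierNeighbours} (allFin (n G))
      (Any.reverse⁻ (∈-bucket⁻ {H = byUpper} u∈))))
  ... | u∈adj , u≺v = Graph.adj-sym G u∈adj , u≺v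

  ∈-cogroup-lowerEnds⁺ : ∀ {e} → Directed e → e ∈ cogroup lowerEnds descending
  ∈-cogroup-lowerEnds⁺ {u , v} d = subst ((u , v) ∈_) (sym (cogroup≡swap-group lowerEnds descending))
    (∈-map⁺ swap (∈-group⁺ (∈-descending v) (∈-lowerEnds⁺ d)))

  ∈-cogroup-lowerEnds⁻ : ∀ {e} → e ∈ cogroup lowerEnds descending → Directed e
  ∈-cogroup-lowerEnds⁻ {u , v} e∈
    with ∈-map⁻ swap (subst ((u , v) ∈_) (cogroup≡swap-group lowerEnds descending) e∈)
  ... | _ , ve∈ , refl = ∈-lowerEnds⁻ (proj₂ (∈-group⁻ {f = lowerEnds} descending ve∈))

  ∈-sortedPairs⁺ : ∀ {e} → Directed e → e ∈ sortedPairs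
  ∈-sortedPairs⁺ {u , v} d =
    ∈-group⁺ (∈-ascending u) (∈-bucket⁺ (Any.reverse⁺ (∈-cogroup-lowerEnds⁺ d)))

  ∈-sortedPairs⁻ : ∀ {e} → e ∈ sortedPairs → Directed e
  ∈-sortedPairs⁻ {u , v} e∈ = ∈-cogroup-lowerEnds⁻
    (Any.reverse⁻ (∈-bucket⁻ {H = byLower} (proj₂ (∈-group⁻ {f = upperEnds} ascending e∈))))

  group-unique : ∀ (f : V G → List (V G)) → (∀ v → Unique (f v)) → Unique (group f (allFin (n G)))
  group-unique f f! = AllPairs-group (Unique.allFin⁺ (n G)) (λ a≢a′ → a≢a′ ∘ cong proj₁)
    (λ v → AllPairs.map (λ b≢b′ → b≢b′ ∘ cong proj₂) (f! v))

  -- Distinct pairs with the same key differ in the other component. The order inside `lowerEnds v`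
  -- depends on the input; distinctness is all that the ordering argument asks of it.
  lowerEnds-unique : ∀ v → Unique (lowerEnds v)
  lowerEnds-unique v = AllPairs-bucket v (AllPairs.map
    (λ e≢e′ i≡i′ b≡b′ → e≢e′ (sym (cong₂ _,_ i≡i′ b≡b′)))
    (AllPairs-reverse (group-unique earlierNeighbours
      (λ v → Unique.filter⁺ (earlier? v) (Graph.adj-uniq G v)))))

  -- Different `v` are visited in decreasing position. Within one `v` the lower ends are distinct,
  -- so there the premise `u ≡ u′` is contradictory.
  cogroup-lowerEnds-sorted : AllPairs (λ { (u , v) (u′ , v′) → u ≡ u′ → v′ ≺[ G , σ ] v })
                                      (cogroup lowerEnds descending)
  cogroup-lowerEnds-sorted = subst (AllPairs _) (sym (cogroup≡swap-group lowerEnds descending))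
    (AllPairs.map⁺ (AllPairs-group descending-sorted (λ v′≺v _ → v′≺v)
      (λ v → AllPairs.map (λ u≢u′ u≡u′ → contradiction u≡u′ u≢u′) (lowerEnds-unique v))))

  upperEnds-sorted : ∀ u → AllPairs (λ v v′ → v ≺[ G , σ ] v′) (upperEnds u)
  upperEnds-sorted u = AllPairs-bucket u
    (AllPairs.map (λ R → R ∘ sym) (AllPairs-reverse cogroup-lowerEnds-sorted))

  StarBefore : V G × V G → V G × V G → Set
  StarBefore (a , b) (u , v) = a ≺[ G , σ ] u ⊎ (a ≡ u × b ≺[ G , σ ] v)

  sortedPairs-sorted : AllPairs StarBefore sortedPairs
  sortedPairs-sorted = AllPairs-group ascending-sorted inj₁
    (λ u → AllPairs.map (λ v≺v′ → inj₂ (refl , v≺v′)) (upperEnds-sorted u))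

  StarBefore-irrefl : ∀ {e} → ¬ StarBefore e e
  StarBefore-irrefl (inj₁ a≺a)       = <-irrefl refl a≺a
  StarBefore-irrefl (inj₂ (_ , b≺b)) = <-irrefl refl b≺b

  StarBefore-asym : ∀ {e f} → StarBefore e f → ¬ StarBefore f e
  StarBefore-asym (inj₁ a≺u)          (inj₁ u≺a)          = <-asym a≺u u≺a
  StarBefore-asym (inj₁ a≺a)          (inj₂ (refl , _))   = <-irrefl refl a≺a
  StarBefore-asym (inj₂ (refl , _))   (inj₁ a≺a)          = <-irrefl refl a≺a
  StarBefore-asym (inj₂ (refl , b≺v)) (inj₂ (_ , v≺b))    = <-asym b≺v v≺b

  -- An edge gives two arcs, of which every linear order of the vertices selects one.

  arcs : List (V G × V G)
  arcs = group (adj G) (allFin (n G))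

  arcs-unique : Unique arcs
  arcs-unique = group-unique (adj G) (Graph.adj-uniq G)

  arcs-↭-swap : arcs ↭ map swap arcs
  arcs-↭-swap = unique-sets-↭ arcs-unique (Unique.map⁺ (λ { refl → refl }) arcs-unique)
    (λ e∈ → ∈-map⁺ swap (reversed e∈)) (λ e∈ → unswap (∈-map⁻ swap e∈))
    where
    reversed : ∀ {e} → e ∈ arcs → swap e ∈ arcs
    reversed {u , v} e∈ = ∈-group⁺ (∈-allFin v)
      (Graph.adj-sym G (proj₂ (∈-group⁻ {f = adj G} (allFin (n G)) e∈)))
    unswap : ∀ {e} → ∃[ f ] f ∈ arcs × e ≡ swap f → e ∈ arcs
    unswap (f , f∈ , refl) = reversed f∈

  -- Swapping permutes the arcs, so as many arcs satisfy `P` as `P ∘ swap`; on arcs the two are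
  -- complementary, since no arc is a loop.
  arcs-split : {P : V G × V G → Set} (P? : Decidable P) →
    (∀ {u v} → u ≢ v → P (u , v) ⊎ P (v , u)) → (∀ {u v} → P (u , v) → ¬ P (v , u)) →
    length (filter P? arcs) + length (filter P? arcs) ≡ length arcs
  arcs-split P? total asym = trans
    (cong (length (filter P? arcs) +_)
      (trans (↭-length (filter-↭ P? arcs-↭-swap)) (length-filter-map P? swap arcs)))
    (length-filter-complement P? (P? ∘ swap) arcs
      (λ {e} e∈ → total λ u≡v → Graph.adj-irr G (proj₁ e)
        (subst (_∈ adj G (proj₁ e)) (sym u≡v) (proj₂ (∈-group⁻ {f = adj G} (allFin (n G)) e∈))))
      asym)

  module _ (rank : V G → V G) (rank-injective : ∀ {u v} → rank u ≡ rank v → u ≡ v) where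

    ascends? : Decidable {A = V G × V G} (λ e → rank (proj₁ e) Fin.< rank (proj₂ e))
    ascends? e = rank (proj₁ e) Fin.<? rank (proj₂ e)

    ascends-total : ∀ {u v} → u ≢ v → rank u Fin.< rank v ⊎ rank v Fin.< rank u
    ascends-total {u} {v} u≢v with Fin.<-cmp (rank u) (rank v)
    ... | tri< lt _ _ = inj₁ lt
    ... | tri≈ _ eq _ = contradiction (rank-injective eq) u≢v
    ... | tri> _ _ gt = inj₂ gt

    arcs-ascending : length (filter ascends? arcs) + length (filter ascends? arcs) ≡ length arcs
    arcs-ascending = arcs-split ascends? ascends-total (λ {u} {v} lt gt → <-asym lt gt)

  -- With the identity as rank, the selected arcs are `edgeList` by definition.
  length-arcs : length arcs ≡ m G + m G
  length-arcs = sym (arcs-ascending (λ v → v) (λ eq → eq))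

  double-injective : ∀ {i j} → i + i ≡ j + j → i ≡ j
  double-injective {i} {j} eq = *-cancelˡ-≡ i j 2
    (trans (cong (i +_) (+-identityʳ i)) (trans eq (sym (cong (j +_) (+-identityʳ j)))))

  -- Such a list is a permutation of the arcs that ascend in σ. These are half of all arcs, and so
  -- are the label-ascending ones that `m` counts.
  length-directed : ∀ {es} → Unique es → (∀ {e} → Directed e → e ∈ es) →
                    (∀ {e} → e ∈ es → Directed e) →
                    length es ≡ m G
  length-directed {es} es! complete sound = trans
    (↭-length (unique-sets-↭ es! (Unique.filter⁺ directed? arcs-unique)
      (λ e∈ → let (v∈ , u≺v) = sound e∈ in ∈-filter⁺ directed? (∈-group⁺ (∈-allFin _) v∈) u≺v)
      (λ e∈ → let (e∈arcs , u≺v) = ∈-filter⁻ directed? {xs = arcs} e∈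
              in complete (proj₂ (∈-group⁻ {f = adj G} (allFin (n G)) e∈arcs) , u≺v))))
    (double-injective (trans (arcs-ascending position position-injective) length-arcs))
    where
    directed? = ascends? position position-injective

  length-sortedPairs : length sortedPairs ≡ m G
  length-sortedPairs = length-directed
    (AllPairs.map (λ { R refl → StarBefore-irrefl R }) sortedPairs-sorted)
    ∈-sortedPairs⁺ ∈-sortedPairs⁻

  length-cogroup-lowerEnds : length (cogroup lowerEnds descending) ≡ m G
  length-cogroup-lowerEnds = length-directed
    (AllPairs.map (λ { R refl → <-irrefl refl (R refl) }) cogroup-lowerEnds-sorted)
    ∈-cogroup-lowerEnds⁺ ∈-cogroup-lowerEnds⁻

  encodePair : V G × V G → List ℕ
  encodePair (u , v) = toℕ u ∷ toℕ v ∷ []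

  -- From a sorted list of pairs to an enumeration of the edges

  module _ (es : List (V G × V G)) (sorted : AllPairs StarBefore es)
           (complete : ∀ {e} → Directed e → e ∈ es) (sound : ∀ {e} → e ∈ es → Directed e) where

    enumerate : Fin (length es) → Edge G
    enumerate i = edge (proj₁ (lookup es i)) (proj₂ (lookup es i)) (proj₁ (sound (∈-lookup i)))

    lookup-sorted : ∀ {i j} → i Fin.< j → StarBefore (lookup es i) (lookup es j)
    lookup-sorted = go sorted
      where
      go : ∀ {es} → AllPairs StarBefore es →
           ∀ {i j} → i Fin.< j → StarBefore (lookup es i) (lookup es j)
      go (R ∷ Rs) {Fin.zero}  {Fin.suc j} _    = All.lookup R (∈-lookup j)
      go (R ∷ Rs) {Fin.suc i} {Fin.suc j} i<j  = go Rs (s<s⁻¹ i<j)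

    -- Only one of the two ways to write an edge ascends in σ, so the witnesses in `StarPrecedes`
    -- can only be the stored pair.
    directed-end : ∀ {i a b} → enumerate i IsEdge a — b → a ≺[ G , σ ] b → lookup es i ≡ (a , b)
    directed-end     (inj₁ (refl , refl)) a≺b = refl
    directed-end {i} (inj₂ (refl , refl)) a≺b = contradiction (proj₂ (sound (∈-lookup i))) (<-asym a≺b)

    ascends : ∀ i → proj₁ (lookup es i) ≺[ G , σ ] proj₂ (lookup es i)
    ascends i = proj₂ (sound (∈-lookup i))

    lookup-reflects : ∀ i j → StarBefore (lookup es i) (lookup es j) → i Fin.< j
    lookup-reflects i j R with Fin.<-cmp i j
    ... | tri< i<j _ _  = i<j
    ... | tri≈ _ refl _ = contradiction R StarBefore-irrefl
    ... | tri> _ _ j<i  = contradiction R (StarBefore-asym (lookup-sorted j<i))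

    -- Equal edges have the same ascending pair, while the entries at different indices are related
    -- by the irreflexive `StarBefore`.
    enumerate-injective : ∀ {i j} → enumerate i ≈ᴱ enumerate j → i ≡ j
    enumerate-injective {i} {j} eq with Fin.<-cmp i j | directed-end {i} eq (ascends j)
    ... | tri< i<j _ _ | same =
      contradiction (subst (λ e → StarBefore e (lookup es j)) same (lookup-sorted i<j)) StarBefore-irrefl
    ... | tri≈ _ i≡j _ | _    = i≡j
    ... | tri> _ _ j<i | same =
      contradiction (subst (StarBefore (lookup es j)) same (lookup-sorted j<i)) StarBefore-irrefl

    enumerate-surjective : ∀ (e : Edge G) → ∃[ i ] enumerate i ≈ᴱ e
    enumerate-surjective (edge a b b∈) with Fin.<-cmp (position a) (position b)
    ... | tri< a≺b _ _ = let ab∈ = complete (b∈ , a≺b); eq = Any.lookup-index ab∈ in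
      Any.index ab∈ , inj₁ (cong proj₁ (sym eq) , cong proj₂ (sym eq))
    ... | tri≈ _ a≡b _ =
      contradiction (subst (_∈ adj G a) (sym (position-injective a≡b)) b∈) (Graph.adj-irr G a)
    ... | tri> _ _ b≺a = let ba∈ = complete (Graph.adj-sym G b∈ , b≺a); eq = Any.lookup-index ba∈ in
      Any.index ba∈ , inj₂ (cong proj₁ (sym eq) , cong proj₂ (sym eq))

    -- With `k` a variable the length equation can be matched by `refl`, so no transport of the
    -- enumeration along `length sortedPairs ≡ m G` arises.
    enumerate-starOrder : ∀ {k} → length es ≡ k → ∃[ π ]
      Bijective _≡_ (_≈ᴱ_ {G}) π
      × (∀ i j → (i Fin.< j) ⇔ StarPrecedes G σ (π i) (π j))
      × encodeEdges {G} {k} π ≡ concatMap encodePair es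
    enumerate-starOrder refl = enumerate
      , (enumerate-injective , λ e → let i , eq = enumerate-surjective e in i , λ { refl → eq })
      , (λ i j → mk⇔
          (λ i<j → _ , _ , _ , _ , inj₁ (refl , refl) , ascends i ,
                   inj₁ (refl , refl) , ascends j , lookup-sorted i<j)
          (λ (a , b , u , v , i≈ab , a≺b , j≈uv , u≺v , R) → lookup-reflects i j
            (subst₂ StarBefore (sym (directed-end {i} i≈ab a≺b))
                               (sym (directed-end {j} j≈uv u≺v)) R)))
      , trans (sym (List.concatMap-map encodePair ends (tabulate enumerate)))
          (cong (concatMap encodePair)
            (trans (List.map-tabulate enumerate ends) (List.tabulate-lookup es)))
      where
      ends : Edge G → V G × V G
      ends e = end₁ e , end₂ e

-- The sorting program

order one index left count this that scratch old fresh cursor : Var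
order   = # 0
one     = # 1
index   = # 2
left    = # 3
count   = # 4
this    = # 5
that    = # 6
scratch = # 7
old     = # 8
fresh   = # 9
cursor  = # 10

-- Linked lists: a node i > 0 holds value[i] and points to node next[i]; 0 is the
-- empty list.  The two families of lists share their nodes.
positions vertices lowerHead upperHead value next : Array
positions = # 0
vertices  = # 1
lowerHead = # 2
upperHead = # 3
value     = # 4
next      = # 5

push : Array → Var → Var → List Op
push head key item =
  add fresh one fresh ∷ put value fresh item ∷ get old head key ∷ put next fresh old ∷
  put head key fresh ∷ []

-- Subtracting the freshly cleared `index` serves to copy `order` into `left`.
start advance : List Op
start   = const index 0 ∷ sub left order index ∷ []
advance = add index one index ∷ sub left left one ∷ []

forEachVertex : Code → Code
forEachVertex C = exec start ⨾ while left (C ⨾ exec advance)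

initialize scanOrdering readAdjacency regroup printEdges starSort : Code

initialize = exec (read order ∷ const one 1 ∷ [])

scanOrdering = forEachVertex
  (exec (read this ∷ put positions index this ∷ put vertices this index ∷ []))

-- Truncated subtraction is the comparison: the difference of the positions is positive exactly when
-- the neighbour comes earlier.
readNeighbour = exec (read this ∷ get scratch positions index ∷ get old positions this ∷
                      sub scratch scratch old ∷ [])
  ⨾ ifPos scratch (exec (push lowerHead index this))
  ⨾ exec (sub count count one ∷ [])

readAdjacency = forEachVertex (exec (read count ∷ []) ⨾ while count readNeighbour)

-- As `left` counts down from n, `left` minus one runs through the positions in decreasing order.
regroup = forEachVertex
  (exec (sub scratch left one ∷ get that vertices scratch ∷ get cursor lowerHead that ∷ [])
  ⨾ while cursor (exec (get this value cursor ∷ push upperHead this that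
                        ++ get cursor next cursor ∷ [])))

printEdges = forEachVertex
  (exec (get this vertices index ∷ get cursor upperHead this ∷ [])
  ⨾ while cursor (exec (get that value cursor ∷ prnt this ∷ prnt that
                        ∷ get cursor next cursor ∷ [])))

starSort = initialize ⨾ scanOrdering ⨾ readAdjacency ⨾ regroup ⨾ printEdges

program : Program
program = compile 0 starSort ++ halt ∷ []

-- Linked lists in the arrays

module _ {k : ℕ} where

  -- The index is 0 exactly for the empty list, so a loop test on a cursor agrees with the ghost
  -- list. `top` is the last allocated node.
  data Chain (value next : ℕ → ℕ) (top : ℕ) : ℕ → List (Fin k) → Set where
    []   : Chain value next top 0 []
    link : ∀ {i v vs} → suc i ≤ top → value (suc i) ≡ toℕ v →
           Chain value next top (next (suc i)) vs → Chain value next top (suc i) (v ∷ vs)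

  Chains : (value next : ℕ → ℕ) → ℕ → (ℕ → ℕ) → (Fin k → List (Fin k)) → Set
  Chains value next top head f = ∀ v → Chain value next top (head (toℕ v)) (f v)

  -- Only node `suc top` is written, and no existing chain passes through it. Hence both families
  -- can share the arrays, and a list can be traversed while others grow.
  Chain-allocate : ∀ {value next top i vs x y} → Chain value next top i vs →
                   Chain (value [ suc top ≔ x ]) (next [ suc top ≔ y ]) (suc top) i vs
  Chain-allocate [] = []
  Chain-allocate {value} {next} {top} {x = x} {y} (link {i} {vs = vs} i<top val≡ chain) =
    link (m≤n⇒m≤1+n i<top) (trans (update-other value {x = x} (<⇒≢ (s≤s i<top))) val≡)
      (subst (λ j → Chain (value [ suc top ≔ x ]) (next [ suc top ≔ y ]) (suc top) j vs)
        (sym (update-other next {x = y} (<⇒≢ (s≤s i<top)))) (Chain-allocate chain))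

  Chain-tail : ∀ {value next top i v vs} → Chain value next top (suc i) (v ∷ vs) →
               Chain value next top (next (suc i)) vs
  Chain-tail (link _ _ chain) = chain

  Chains-push : ∀ {value next top head H key item} {i v : Fin k} →
                key ≡ toℕ i → item ≡ toℕ v → Chains value next top head (bucket H) →
                Chains (value [ suc top ≔ item ]) (next [ suc top ≔ head key ]) (suc top)
                       (head [ key ≔ suc top ]) (bucket ((i , v) ∷ H))
  Chains-push {value} {next} {top} {head} {H} {i = i} {v} refl refl chains j with i Fin.≟ j
  ... | yes refl = subst (λ h → Chain value′ next′ (suc top) h (v ∷ bucket H j))
      (sym (update-same head (toℕ i)))
      (link ≤-refl (update-same value (suc top))
        (subst (λ h → Chain value′ next′ (suc top) h (bucket H j))
          (sym (update-same next (suc top))) (Chain-allocate (chains j))))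
    where
    value′ = value [ suc top ≔ toℕ v ]
    next′  = next [ suc top ≔ head (toℕ i) ]
  ... | no i≢j = subst (λ h → Chain _ _ (suc top) h (bucket H j))
      (sym (update-other head (i≢j ∘ sym ∘ Fin.toℕ-injective))) (Chain-allocate (chains j))

  Rising : ℕ → List (Fin k) → Set
  Rising i []       = ⊤
  Rising i (v ∷ vs) = i ≡ toℕ v × Rising (suc i) vs

  -- The head equals the number of entries after it, which is `left` minus one in the loop.
  Falling : List (Fin k) → Set
  Falling []       = ⊤
  Falling (v ∷ vs) = length vs ≡ toℕ v × Falling vs

  rising-tabulate : ∀ {l} i (f : Fin l → Fin k) →
                    (∀ j → i + toℕ j ≡ toℕ (f j)) → Rising i (tabulate f)
  rising-tabulate {zero}  i f eq = tt
  rising-tabulate {suc l} i f eq = trans (sym (+-identityʳ i)) (eq Fin.zero) ,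
    rising-tabulate (suc i) (f ∘ Fin.suc) (λ j → trans (sym (+-suc i (toℕ j))) (eq (Fin.suc j)))

  falling-tabulate : ∀ {l} (f : Fin l → Fin k) →
                     (∀ j → l ∸ suc (toℕ j) ≡ toℕ (f j)) → Falling (tabulate f)
  falling-tabulate {zero}  f eq = tt
  falling-tabulate {suc l} f eq = trans (List.length-tabulate (f ∘ Fin.suc)) (eq Fin.zero) ,
    falling-tabulate (f ∘ Fin.suc) (eq ∘ Fin.suc)

-- Correctness, running time and word size of the loops

module Correctness (G : Graph) (σ : Ordering G) (W : ℕ)
                   (W-large : suc (n G + (m G + m G + m G)) * 6 ≤ W) where

  open Sorting G σ
  open Execution W

  -- A common bound for vertices, degrees and nodes. Node numbers stay within 3m: one is budgeted
  -- per adjacency entry while reading and one per edge while regrouping.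
  capacity : ℕ
  capacity = n G + (m G + m G + m G)

  fits : ∀ {i} a → i ≤ capacity → cell a i < W
  fits {i} a i≤ = ≤-trans
    (subst (_< suc i * 6) (sym (cell≡toℕ+i*6 a i)) (+-monoˡ-< (i * 6) (Fin.toℕ<n a)))
    (≤-trans (*-monoˡ-≤ 6 (s≤s i≤)) W-large)

  small : ∀ {i} → i ≤ capacity → i < W
  small {i} i≤ = ≤-trans (s≤s i≤) (≤-trans (m≤m*n (suc capacity) 6) W-large)

  toℕ<capacity : (v : V G) → toℕ v < capacity
  toℕ<capacity v = ≤-trans (Fin.toℕ<n v) (m≤m+n _ _)

  toℕ≤capacity : (v : V G) → toℕ v ≤ capacity
  toℕ≤capacity v = <⇒≤ (toℕ<capacity v)

  0<W : 0 < W
  0<W = small z≤n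

  zeros : ℕ → ℕ
  zeros _ = 0

  -- The slots of `order` and `one` are fixed at n and 1, which nothing changes after
  -- initialisation.
  memory : (i l d u v x y c e : ℕ) (pos inv low upp val nxt : ℕ → ℕ) (is os : List ℕ) → Store
  memory i l d u v x y c e pos inv low upp val nxt =
    store (n G ∷ 1 ∷ i ∷ l ∷ d ∷ u ∷ v ∷ x ∷ y ∷ c ∷ e ∷ [])
          (pos ∷ inv ∷ low ∷ upp ∷ val ∷ nxt ∷ [])

  record Tables (pos inv : ℕ → ℕ) : Set where
    constructor tables
    field
      pos≡ : ∀ v → pos (toℕ v) ≡ toℕ (position v)
      inv≡ : ∀ p → inv (toℕ p) ≡ toℕ (vertexAt p)

  open Tables

  encodeVertex : V G → List ℕ
  encodeVertex v = length (adj G v) ∷ map toℕ (adj G v)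

  encodedAdjacency : List ℕ
  encodedAdjacency = concatMap encodeVertex (allFin (n G))

  rising-allFin : Rising 0 (allFin (n G))
  rising-allFin = rising-tabulate 0 (λ v → v) (λ _ → refl)

  -- Scanning the ordering

  data Scanning (vs : List (V G)) : Store → Set where
    scanning : ∀ {i d u v x y e pos inv} → Rising i vs →
      (∀ v → v ∈ vs ⊎ (pos (toℕ v) ≡ toℕ (position v) × inv (toℕ (position v)) ≡ toℕ v)) →
      Scanning vs (memory i (length vs) d u v x y 0 e pos inv zeros zeros zeros zeros
        (map (toℕ ∘ position) vs ++ encodedAdjacency) [])

  data Initialized : Store → Set where
    initialized : ∀ {i l d u v x y e pos inv} →
      Initialized (memory i l d u v x y 0 e pos inv zeros zeros zeros zeros
        (map (toℕ ∘ position) (allFin (n G)) ++ encodedAdjacency) [])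

  loopStart : ℕ → Store → Store
  loopStart l (store R A is os) = store ((R Vec.[ index ]≔ 0) Vec.[ left ]≔ l) A is os

  forEachVertex-rule : ∀ {C s} (I : List (V G) → Store → Set) (b : V G → ℕ) vs →
    length vs ≡ Vec.lookup (Store.vars s) order → I vs (loopStart (length vs) s) →
    (∀ {s} → I [] s → Vec.lookup (Store.vars s) left ≡ 0) →
    (∀ {v vs s} → I (v ∷ vs) s → 0 < Vec.lookup (Store.vars s) left) →
    (∀ {v vs s} → I (v ∷ vs) s → Achieves (C ⨾ exec advance) s (b v) (I vs)) →
    Achieves (forEachVertex C) s (2 + loopTime b vs) (I [])
  -- Exposing four entries of the vector lets the updates of `index` and `left` compute.
  forEachVertex-rule {s = s@(store (_ ∷ _ ∷ _ ∷ _ ∷ _) _ _ _)} I b vs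
    length≡ i stop go body = seq-rule {I = I vs}
    (exec-rule start (0<W , tt , tt) (subst (λ l → I vs (loopStart l s)) length≡ i))
    (while-rule I b 0<W stop go body vs)

  length-allFin : length (allFin (n G)) ≡ n G
  length-allFin = List.length-tabulate _

  scan-vertex : ∀ {v vs s} → Scanning (v ∷ vs) s → Achieves
    (exec (read this ∷ put positions index this ∷ put vertices this index ∷ []) ⨾ exec advance) s 15
    (Scanning vs)
  scan-vertex {v} {vs} (scanning {pos = pos} {inv} (refl , rising) known) = exec-seq-rule _
    (small (toℕ≤capacity _) , fits positions (toℕ≤capacity v) ,
     fits vertices (toℕ≤capacity (position v)) , tt)
    (exec-rule advance (small (toℕ<capacity v) , tt , tt) (scanning rising known′))
    where
    pos′ = pos [ toℕ v ≔ toℕ (position v) ]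
    inv′ = inv [ toℕ (position v) ≔ toℕ v ]
    known′ : ∀ w → w ∈ vs ⊎ (pos′ (toℕ w) ≡ toℕ (position w) × inv′ (toℕ (position w)) ≡ toℕ w)
    known′ w with w Fin.≟ v
    ... | yes refl = inj₂ (update-same pos (toℕ v) , update-same inv (toℕ (position v)))
    ... | no w≢v with known w
    ...   | inj₁ (here w≡v) = contradiction w≡v w≢v
    ...   | inj₁ (there w∈) = inj₁ w∈
    ...   | inj₂ (p , q)    = inj₂
      ( trans (update-other pos (w≢v ∘ Fin.toℕ-injective)) p
      , trans (update-other inv (w≢v ∘ position-injective ∘ Fin.toℕ-injective)) q)

  scanOrdering-correct : ∀ {s} → Initialized s →
    Achieves scanOrdering s (2 + loopTime (λ _ → 15) (allFin (n G))) (Scanning [])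
  scanOrdering-correct initialized = forEachVertex-rule Scanning (λ _ → 15) (allFin (n G))
    length-allFin (scanning rising-allFin (inj₁ ∘ ∈-allFin))
    (λ { (scanning _ _) → refl }) (λ { (scanning _ _) → z<s }) scan-vertex

  Scanning⇒Tables : ∀ {pos inv : ℕ → ℕ} →
    (∀ v → v ∈ [] ⊎ (pos (toℕ v) ≡ toℕ (position v) × inv (toℕ (position v)) ≡ toℕ v)) →
    Tables pos inv
  Scanning⇒Tables {pos} {inv} known = tables (λ v → proj₁ (found v))
    (λ p → subst (λ q → inv (toℕ q) ≡ toℕ (vertexAt p)) (position-vertexAt p)
                 (proj₂ (found (vertexAt p))))
    where
    found : ∀ v → pos (toℕ v) ≡ toℕ (position v) × inv (toℕ (position v)) ≡ toℕ v
    found v with known v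
    ... | inj₂ pq = pq

  -- Reading the adjacency lists

  degreeSum : List (V G) → ℕ
  degreeSum vs = length (concatMap (adj G) vs)

  -- With `H` empty and all vertices due, the history equation is the definition of `byUpper`. The
  -- last premise charges a node to every unread adjacency entry, whether or not it will be pushed.
  data Reading (vs : List (V G)) : Store → Set where
    reading : ∀ {i d u v x y c e pos inv low val nxt H} → Rising i vs → Tables pos inv →
      Chains val nxt c low (bucket H) → group earlierNeighbours vs ʳ++ H ≡ byUpper →
      c + degreeSum vs ≤ m G + m G →
      Reading vs (memory i (length vs) d u v x y c e pos inv low zeros val nxt
        (concatMap encodeVertex vs) [])

  data ReadingAt (w : V G) (vs us : List (V G)) : Store → Set where
    readingAt : ∀ {u v x y c e pos inv low val nxt H} → Tables pos inv →
      Chains val nxt c low (bucket H) →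
      (map (w ,_) (filter (earlier? w) us) ++ group earlierNeighbours vs) ʳ++ H ≡ byUpper →
      c + (length us + degreeSum vs) ≤ m G + m G →
      ReadingAt w vs us (memory (toℕ w) (suc (length vs)) (length us) u v x y c e
        pos inv low zeros val nxt (map toℕ us ++ concatMap encodeVertex vs) [])

  2m≤capacity : m G + m G ≤ capacity
  2m≤capacity = ≤-trans (m≤m+n _ _) (m≤n+m _ (n G))

  push-safe : ∀ {c h key} → suc c ≤ capacity → key ≤ capacity →
    suc c < W × cell value (suc c) < W × cell h key < W × cell next (suc c) < W × cell h key < W × ⊤
  push-safe {h = h} c< key≤ =
    small c< , fits value c< , fits h key≤ , fits next c< , fits h key≤ , tt

  -- Array accesses cost 6 steps, so the 41 are 14 before the test, 26 for the test and the push,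
  -- and 1 for the countdown.
  read-neighbour : ∀ {w vs u us s} → ReadingAt w vs (u ∷ us) s →
                   Achieves readNeighbour s 41 (ReadingAt w vs us)
  read-neighbour {w} {vs} {u} {us}
    (readingAt {c = c} {pos = pos} {inv} {low} {val} {nxt} {H} tabs chains remaining c≤) =
    exec-seq-rule _
      (small (toℕ≤capacity u) , fits positions (toℕ≤capacity w) ,
       fits positions (toℕ≤capacity u) , tt , tt)
      (seq-rule {I = Noted} noted λ { (note {H = H} chains remaining c≤) →
        exec-rule _ (tt , tt) (readingAt {H = H} tabs chains remaining c≤) })
    where
    rest = group earlierNeighbours vs
    is = map toℕ us ++ concatMap encodeVertex vs
    s₁ = memory (toℕ w) (suc (length vs)) (suc (length us)) (toℕ u) _ (pos (toℕ w) ∸ pos (toℕ u)) _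
           c _ pos inv low zeros val nxt is []
    data Noted : Store → Set where
      note : ∀ {v x y c e low val nxt H} → Chains val nxt c low (bucket H) →
        (map (w ,_) (filter (earlier? w) us) ++ rest) ʳ++ H ≡ byUpper →
        c + (length us + degreeSum vs) ≤ m G + m G →
        Noted (memory (toℕ w) (suc (length vs)) (suc (length us)) (toℕ u) v x y c e
          pos inv low zeros val nxt is [])
    sc≤ : suc c + (length us + degreeSum vs) ≤ m G + m G
    sc≤ = subst (_≤ m G + m G) (+-suc c _) c≤
    difference : pos (toℕ w) ∸ pos (toℕ u) ≡ toℕ (position w) ∸ toℕ (position u)
    difference = cong₂ _∸_ (pos≡ tabs w) (pos≡ tabs u)
    noted : Achieves (ifPos scratch (exec (push lowerHead index this))) s₁ 26 Noted
    noted with earlier? w u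
    ... | yes u≺w = then-rule (subst (0 <_) (sym difference) (m<n⇒0<n∸m u≺w))
      (exec-rule (push lowerHead index this)
        (push-safe {h = lowerHead} (≤-trans (≤-trans (m≤m+n (suc c) _) sc≤) 2m≤capacity)
          (toℕ≤capacity w))
        (note {H = (w , u) ∷ H} (Chains-push {head = low} {H} refl refl chains)
          (trans (cong (λ vs → (map (w ,_) vs ++ rest) ʳ++ H)
            (sym (List.filter-accept (earlier? w) u≺w))) remaining)
          sc≤))
    -- Skipping takes a single step, padded to 26 so that both branches meet one bound.
    ... | no ¬u≺w = weaken (s≤s z≤n) (skip-rule (trans difference (m≤n⇒m∸n≡0 (≮⇒≥ ¬u≺w)))
      (note {H = H} chains
        (trans (cong (λ vs → (map (w ,_) vs ++ rest) ʳ++ H)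
          (sym (List.filter-reject (earlier? w) ¬u≺w))) remaining)
        (<⇒≤ sc≤)))

  -- The degree is itself an input word and has to fit; the budget for unread entries already bounds
  -- it by 2m.
  degree≤ : ∀ {c v vs} → c + degreeSum (v ∷ vs) ≤ m G + m G → length (adj G v) ≤ capacity
  degree≤ {c} {v} {vs} c≤ = ≤-trans (≤-trans (≤-trans
    (≤-trans (m≤m+n _ _) (≤-reflexive (sym (List.length-++ (adj G v) {concatMap (adj G) vs}))))
    (m≤n+m _ c)) c≤) 2m≤capacity

  read-vertex : ∀ {v vs s} → Reading (v ∷ vs) s → Achieves
    ((exec (read count ∷ []) ⨾ while count readNeighbour) ⨾ exec advance) s
    (4 + 44 * length (adj G v)) (Reading vs)
  read-vertex {v} {vs} (reading {c = c} {H = H} (refl , rising) tabs chains remaining c≤) =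
    weaken (≤-reflexive time≡) (seq-rule {I = ReadingAt v vs []}
      (seq-rule {I = ReadingAt v vs (adj G v)}
        (exec-rule _ (small (degree≤ {c} {v} {vs} c≤) , tt)
          (readingAt {H = H} tabs chains remaining
            (subst (λ l → c + l ≤ m G + m G) (List.length-++ (adj G v)) c≤)))
        (while-rule (ReadingAt v vs) (λ _ → 41) 0<W
          (λ { (readingAt _ _ _ _) → refl }) (λ { (readingAt _ _ _ _) → z<s })
          read-neighbour (adj G v)))
      λ { (readingAt {H = H} tabs chains remaining c≤) →
          exec-rule advance (small (toℕ<capacity v) , tt , tt)
            (reading {H = H} rising tabs chains remaining c≤) })
    where
    arith : ∀ d → 1 + (1 + 44 * d) + 2 ≡ 4 + 44 * d
    arith = solve-∀
    time≡ : 1 + loopTime (λ _ → 41) (adj G v) + 2 ≡ 4 + 44 * length (adj G v)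
    time≡ = trans (cong (λ t → 1 + t + 2) (loopTime-constant 41 (adj G v))) (arith (length (adj G v)))

  degreeSum≡2m : degreeSum (allFin (n G)) ≡ m G + m G
  degreeSum≡2m = trans (sym (length-group (adj G) (allFin (n G)))) length-arcs

  readAdjacency-correct : ∀ {s} → Scanning [] s → Achieves readAdjacency s
    (2 + loopTime (λ v → 4 + 44 * length (adj G v)) (allFin (n G))) (Reading [])
  readAdjacency-correct (scanning _ known) = forEachVertex-rule Reading _ (allFin (n G))
    length-allFin
    (reading {H = []} rising-allFin (Scanning⇒Tables known) (λ _ → []) refl (≤-reflexive degreeSum≡2m))
    (λ { (reading _ _ _ _ _) → refl }) (λ { (reading _ _ _ _ _) → z<s }) read-vertex

  -- Regrouping by the lower end

  -- Here `ps` are positions, and they fall while `index` rises; the separate bound on `i` keeps the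
  -- increment of `index` below the word bound.
  data Regrouping (ps : List (V G)) : Store → Set where
    regrouping : ∀ {i d u v x y c e pos inv low upp val nxt H} →
      Falling ps → i + length ps ≤ n G → Tables pos inv →
      Chains val nxt c low lowerEnds → Chains val nxt c upp (bucket H) →
      cogroup lowerEnds (map vertexAt ps) ʳ++ H ≡ byLower →
      c + length (cogroup lowerEnds (map vertexAt ps)) ≤ m G + m G + m G →
      Regrouping ps (memory i (length ps) d u v x y c e pos inv low upp val nxt [] [])

  data RegroupingAt (i : ℕ) (w : V G) (ps : List (V G)) (us : List (V G)) : Store → Set where
    regroupingAt : ∀ {d u v x y c e pos inv low upp val nxt H} → Tables pos inv →
      v ≡ toℕ w → Chain val nxt c e us →
      Chains val nxt c low lowerEnds → Chains val nxt c upp (bucket H) →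
      (map (_, w) us ++ cogroup lowerEnds (map vertexAt ps)) ʳ++ H ≡ byLower →
      c + (length us + length (cogroup lowerEnds (map vertexAt ps))) ≤ m G + m G + m G →
      RegroupingAt i w ps us (memory i (suc (length ps)) d u v x y c e pos inv low upp val nxt [] [])

  3m≤capacity : m G + m G + m G ≤ capacity
  3m≤capacity = m≤n+m _ (n G)

  regroup-entry : ∀ {i w ps u us s} → RegroupingAt i w ps (u ∷ us) s →
    Achieves (exec (get this value cursor ∷ push upperHead this that
                    ++ get cursor next cursor ∷ [])) s 37
      (RegroupingAt i w ps us)
  regroup-entry {w = w} {ps} {u} {us}
    (regroupingAt {c = c} {upp = upp} {val} {H = H} tabs v≡ entry@(link e≤c val≡ _)
                  lows upps remaining c≤) =
    exec-rule _
      (fits value (≤-trans e≤c c≤cap) , small c<cap , fits value c<cap , fits upperHead u≤ ,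
       fits next c<cap , fits upperHead u≤ , fits next (≤-trans e≤c c≤cap) , tt)
      (regroupingAt {H = (u , w) ∷ H} tabs v≡
        -- The successor is fetched after the push, from the updated `next`, so the chain is first
        -- carried over and only then shortened.
        (Chain-tail (Chain-allocate entry))
        (λ v → Chain-allocate (lows v))
        (Chains-push {head = upp} {H} val≡ v≡ upps) remaining sc≤)
    where
    sc≤ : suc c + (length us + length (cogroup lowerEnds (map vertexAt ps))) ≤ m G + m G + m G
    sc≤ = subst (_≤ m G + m G + m G) (+-suc c _) c≤
    c<cap : suc c ≤ capacity
    c<cap = ≤-trans (≤-trans (m≤m+n (suc c) _) sc≤) 3m≤capacity
    c≤cap : c ≤ capacity
    c≤cap = <⇒≤ c<cap
    u≤ : val _ ≤ capacity
    u≤ = subst (_≤ capacity) (sym val≡) (toℕ≤capacity u)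

  regroup-vertex : ∀ {p ps s} → Regrouping (p ∷ ps) s → Achieves
    ((exec (sub scratch left one ∷ get that vertices scratch ∷ get cursor lowerHead that ∷ [])
      ⨾ while cursor (exec (get this value cursor ∷ push upperHead this that
                            ++ get cursor next cursor ∷ []))) ⨾ exec advance)
    s (16 + 40 * length (lowerEnds (vertexAt p))) (Regrouping ps)
  regroup-vertex {p} {ps}
    (regrouping {i} {c = c} {inv = inv} {low} {H = H} (length≡ , falling) i≤ tabs
                lows upps remaining c≤) =
    weaken (≤-reflexive time≡) (seq-rule {I = RegroupingAt i w ps []}
      (seq-rule {I = RegroupingAt i w ps (lowerEnds w)}
        (exec-rule _
          (tt , fits vertices (subst (_≤ capacity) (sym length≡) (toℕ≤capacity p)) ,
           fits lowerHead (subst (_≤ capacity) (sym inv≡w) (toℕ≤capacity w)) , tt)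
          (regroupingAt {H = H} tabs inv≡w
            (subst (λ v → Chain _ _ c (low v) (lowerEnds w)) (sym inv≡w) (lows w)) lows upps remaining
            (subst (λ l → c + l ≤ m G + m G + m G)
              (trans (List.length-++ (map (_, w) (lowerEnds w)))
                (cong (_+ _) (List.length-map (_, w) (lowerEnds w)))) c≤)))
        (while-rule (RegroupingAt i w ps) (λ _ → 37) 0<W
          (λ { (regroupingAt _ _ [] _ _ _ _) → refl })
          (λ { (regroupingAt _ _ (link _ _ _) _ _ _ _) → z<s }) regroup-entry (lowerEnds w)))
      λ { (regroupingAt {H = H} tabs _ _ lows upps remaining c≤) →
          exec-rule advance (small (≤-trans (m≤m+n (suc i) _) (≤-trans si≤ (m≤m+n (n G) _))) , tt , tt)
            (regrouping {H = H} falling si≤ tabs lows upps remaining c≤) })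
    where
    si≤ : suc i + length ps ≤ n G
    si≤ = subst (_≤ n G) (+-suc i _) i≤
    w = vertexAt p
    inv≡w : inv (length ps) ≡ toℕ w
    inv≡w = trans (cong inv length≡) (inv≡ tabs p)
    arith : ∀ d → 13 + (1 + 40 * d) + 2 ≡ 16 + 40 * d
    arith = solve-∀
    time≡ : 13 + loopTime (λ _ → 37) (lowerEnds w) + 2 ≡ 16 + 40 * length (lowerEnds w)
    time≡ = trans (cong (λ t → 13 + t + 2) (loopTime-constant 37 (lowerEnds w)))
      (arith (length (lowerEnds w)))

  falling-opposite : Falling (tabulate {n = n G} opposite)
  falling-opposite = falling-tabulate opposite (λ j → sym (Fin.opposite-prop j))

  regroup-correct : ∀ {s} → Reading [] s → Achieves regroup s
    (2 + loopTime (λ p → 16 + 40 * length (lowerEnds (vertexAt p))) (tabulate opposite))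
    (Regrouping [])
  -- With no pushes due the history equation is `H ≡ byUpper`; matching it turns `bucket H` into
  -- `lowerEnds`.
  regroup-correct (reading {c = c} _ tabs chains refl c≤) =
    forEachVertex-rule Regrouping _ (tabulate opposite) (List.length-tabulate _)
    (regrouping {H = []} falling-opposite (≤-reflexive (List.length-tabulate _)) tabs chains
      -- Heads that are still zero denote empty lists, so nothing has to be cleared. The node budget
      -- grows by one per edge.
      (λ _ → []) refl (+-mono-≤ (≤-trans (m≤m+n c _) c≤) (≤-reflexive length-cogroup-lowerEnds)))
    (λ { (regrouping _ _ _ _ _ _ _) → refl }) (λ { (regrouping _ _ _ _ _ _ _) → z<s })
    regroup-vertex

  -- Printing the edges

  data Printing (ps : List (V G)) : Store → Set where
    printing : ∀ {i d u v x y c e pos inv low upp val nxt os} → Rising i ps → Tables pos inv →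
      Chains val nxt c upp upperEnds → c ≤ capacity →
      os ++ concatMap encodePair (group upperEnds (map vertexAt ps))
        ≡ concatMap encodePair sortedPairs →
      Printing ps (memory i (length ps) d u v x y c e pos inv low upp val nxt [] os)

  data PrintingAt (p : V G) (ps us : List (V G)) : Store → Set where
    printingAt : ∀ {d u v x y c e pos inv low upp val nxt os} → Tables pos inv →
      u ≡ toℕ (vertexAt p) → Chain val nxt c e us →
      Chains val nxt c upp upperEnds → c ≤ capacity →
      os ++ concatMap encodePair (map (vertexAt p ,_) us ++ group upperEnds (map vertexAt ps))
        ≡ concatMap encodePair sortedPairs →
      PrintingAt p ps us (memory (toℕ p) (suc (length ps)) d u v x y c e pos inv low upp val nxt [] os)

  print-edge : ∀ {p ps u us s} → PrintingAt p ps (u ∷ us) s →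
    Achieves (exec (get that value cursor ∷ prnt this ∷ prnt that ∷ get cursor next cursor ∷ [])) s 14
      (PrintingAt p ps us)
  print-edge {p} {ps} {us = us}
    (printingAt {os = os} tabs refl (link e≤c val≡ chain) chains c≤ printed) =
    exec-rule _ (fits value (≤-trans e≤c c≤) , tt , tt , fits next (≤-trans e≤c c≤) , tt)
      (printingAt tabs refl chain chains c≤
        (trans (List.∷ʳ-++ (os ∷ʳ _) _ _) (trans (List.∷ʳ-++ os _ _)
          (subst (λ j → os ++ toℕ (vertexAt p) ∷ j ∷ rest ≡ concatMap encodePair sortedPairs)
            (sym val≡) printed))))
    where
    rest = concatMap encodePair (map (vertexAt p ,_) us ++ group upperEnds (map vertexAt ps))

  print-vertex : ∀ {p ps s} → Printing (p ∷ ps) s → Achieves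
    ((exec (get this vertices index ∷ get cursor upperHead this ∷ [])
      ⨾ while cursor (exec (get that value cursor ∷ prnt this ∷ prnt that
                            ∷ get cursor next cursor ∷ [])))
      ⨾ exec advance)
    s (15 + 17 * length (upperEnds (vertexAt p))) (Printing ps)
  print-vertex {p} {ps}
    (printing {c = c} {inv = inv} {upp = upp} (refl , rising) tabs chains c≤ printed) =
    weaken (≤-reflexive time≡) (seq-rule {I = PrintingAt p ps []}
      (seq-rule {I = PrintingAt p ps (upperEnds w)}
        (exec-rule _
          (fits vertices (toℕ≤capacity p) ,
           fits upperHead (subst (_≤ capacity) (sym (inv≡ tabs p)) (toℕ≤capacity w)) , tt)
          (printingAt tabs (inv≡ tabs p)
            (subst (λ v → Chain _ _ c (upp v) (upperEnds w)) (sym (inv≡ tabs p)) (chains w))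
            chains c≤ printed))
        (while-rule (PrintingAt p ps) (λ _ → 14) 0<W
          (λ { (printingAt _ _ [] _ _ _) → refl })
          (λ { (printingAt _ _ (link _ _ _) _ _ _) → z<s }) print-edge (upperEnds w)))
      λ { (printingAt tabs _ _ chains c≤ printed) →
          exec-rule advance (small (toℕ<capacity p) , tt , tt)
            (printing rising tabs chains c≤ printed) })
    where
    w = vertexAt p
    arith : ∀ d → 12 + (1 + 17 * d) + 2 ≡ 15 + 17 * d
    arith = solve-∀
    time≡ : 12 + loopTime (λ _ → 14) (upperEnds w) + 2 ≡ 15 + 17 * length (upperEnds w)
    time≡ = trans (cong (λ t → 12 + t + 2) (loopTime-constant 14 (upperEnds w)))
      (arith (length (upperEnds w)))

  printEdges-correct : ∀ {s} → Regrouping [] s → Achieves printEdges s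
    (2 + loopTime (λ p → 15 + 17 * length (upperEnds (vertexAt p))) (allFin (n G))) (Printing [])
  printEdges-correct (regrouping {c = c} _ _ tabs _ chains refl c≤) =
    forEachVertex-rule Printing _ (allFin (n G)) length-allFin
    (printing rising-allFin tabs chains (≤-trans (m≤m+n c _) (≤-trans c≤ 3m≤capacity)) refl)
    (λ { (printing _ _ _ _ _) → refl }) (λ { (printing _ _ _ _ _) → z<s }) print-vertex

  input≡ : encodeInput G σ ≡ n G ∷ map (toℕ ∘ position) (allFin (n G)) ++ encodedAdjacency
  input≡ = cong (λ ps → n G ∷ ps ++ encodedAdjacency)
    (sym (List.map-tabulate (λ v → v) (toℕ ∘ position)))

  startStore : Store
  startStore = store (Vec.replicate 11 0) (Vec.replicate 6 zeros)
    (n G ∷ map (toℕ ∘ position) (allFin (n G)) ++ encodedAdjacency) []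

  -- Initialisation takes 2 steps, and each of the four outer loops 3 for its start and its failing
  -- test. The rest is 62 = 18 + 7 + 19 + 18 per vertex and 145 = 2 * 44 + 40 + 17 per edge, every
  -- edge being read twice.
  totalTime : ℕ
  totalTime = 14 + 62 * n G + 145 * m G

  initialize-correct : Achieves initialize startStore 2 Initialized
  initialize-correct = exec-rule _ (small (m≤m+n _ _) , one<W , tt) initialized
    where
    one<W : 1 < W
    one<W = ≤-trans (s≤s (s≤s z≤n)) W-large

  starSort-correct : Achieves starSort startStore totalTime (Printing [])
  starSort-correct = weaken (≤-reflexive total)
    (seq-rule initialize-correct λ i → seq-rule (scanOrdering-correct i) λ s →
     seq-rule (readAdjacency-correct s) λ r → seq-rule (regroup-correct r) printEdges-correct)
    where
    ps = tabulate {n = n G} opposite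
    lower : length (concatMap (lowerEnds ∘ vertexAt) ps) ≡ m G
    lower = trans (cong length (sym (List.concatMap-map lowerEnds vertexAt ps)))
      (trans (sym (length-cogroup lowerEnds descending)) length-cogroup-lowerEnds)
    upper : length (concatMap (upperEnds ∘ vertexAt) (allFin (n G))) ≡ m G
    upper = trans (cong length (sym (List.concatMap-map upperEnds vertexAt (allFin (n G)))))
      (trans (sym (length-group upperEnds ascending)) length-sortedPairs)
    arith : ∀ n m → 2 + (2 + (1 + 18 * n) + (2 + (1 + 7 * n + 44 * (m + m))
            + (2 + (1 + 19 * n + 40 * m) + (2 + (1 + 18 * n + 17 * m))))) ≡ 14 + 62 * n + 145 * m
    arith = solve-∀
    linear : ∀ (f : V G → List (V G)) k k′ vs → length vs ≡ n G →
             ∀ {l} → length (concatMap f vs) ≡ l →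
             loopTime (λ v → k + k′ * length (f v)) vs ≡ 1 + (3 + k) * n G + k′ * l
    linear f k k′ vs eq eq′ = trans (loopTime-linear f k k′ vs)
      (cong₂ (λ i j → 1 + (3 + k) * i + k′ * j) eq eq′)
    total : 2 + (2 + loopTime (λ _ → 15) (allFin (n G))
              + (2 + loopTime (λ v → 4 + 44 * length (adj G v)) (allFin (n G))
              + (2 + loopTime (λ p → 16 + 40 * length (lowerEnds (vertexAt p))) ps
              + (2 + loopTime (λ p → 15 + 17 * length (upperEnds (vertexAt p))) (allFin (n G))))))
            ≡ totalTime
    total = trans (sum
        (trans (loopTime-constant 15 (allFin (n G))) (cong (λ l → 1 + 18 * l) length-allFin))
        (linear (adj G) 4 44 (allFin (n G)) length-allFin degreeSum≡2m)
        (linear (lowerEnds ∘ vertexAt) 16 40 ps (List.length-tabulate opposite) lower)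
        (linear (upperEnds ∘ vertexAt) 15 17 (allFin (n G)) length-allFin upper))
      (arith (n G) (m G))
      where
      sum : ∀ {a a′ b b′ c c′ d d′} → a ≡ a′ → b ≡ b′ → c ≡ c′ → d ≡ d′ →
            2 + (2 + a + (2 + b + (2 + c + (2 + d))))
            ≡ 2 + (2 + a′ + (2 + b′ + (2 + c′ + (2 + d′))))
      sum refl refl refl refl = refl

  printed-sorted : ∀ {P is} →
    ∃[ s ] ∃[ t ] Printing [] s × t ≤ totalTime × HaltsWith P W is t (Store.out s) →
    ∃[ t ] t ≤ totalTime × HaltsWith P W is t (concatMap encodePair sortedPairs)
  printed-sorted (_ , t , printing {os = os} _ _ _ _ printed , t≤ , halts) =
    t , t≤ , subst (HaltsWith _ W _ t) (trans (sym (List.++-identityʳ os)) printed) halts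

  starSort-halts : ∃[ t ] t ≤ totalTime
                 × HaltsWith program W (encodeInput G σ) t (concatMap encodePair sortedPairs)
  starSort-halts = subst
    (λ is → ∃[ t ] t ≤ totalTime × HaltsWith program W is t (concatMap encodePair sortedPairs))
    (sym input≡)
    (printed-sorted {P = program} (halts-rule {C = starSort} (λ x → sym (Vec.lookup-replicate x 0))
      (λ a i → cong (λ f → f i) (sym (Vec.lookup-replicate a zeros))) starSort-correct))

-- The constants

capacity-bound : ∀ G → suc (n G + (m G + m G + m G)) * 6 ≤ wordBound 6 G
capacity-bound G = begin
  -- The slack `30 + 12 * n G` completes the sum to a multiple of the base `n G + m G + 2`.
  suc (n G + (m G + m G + m G)) * 6       ≤⟨ m≤m+n _ (30 + 12 * n G) ⟩
  suc (n G + (m G + m G + m G)) * 6 + (30 + 12 * n G) ≡⟨ arith (n G) (m G) ⟩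
  (n G + m G + 2) * 18                    ≤⟨ *-monoʳ-≤ (n G + m G + 2) 18≤ ⟩
  (n G + m G + 2) * (n G + m G + 2) ^ 5   ∎
  where
  open ≤-Reasoning
  -- The base is at least 2, and 5 is the least exponent with which a power of 2 reaches 18; one
  -- more factor gives the exponent 6.
  18≤ : 18 ≤ (n G + m G + 2) ^ 5
  18≤ = ≤-trans (≤ᵇ⇒≤ 18 (2 ^ 5) tt) (^-monoˡ-≤ 5 (m≤n+m 2 (n G + m G)))
  arith : ∀ n m → suc (n + (m + m + m)) * 6 + (30 + 12 * n) ≡ (n + m + 2) * 18
  arith = solve-∀

-- The coefficient of `n` is raised from 62 to 145, and `1 ≤ m + n` absorbs the constant 14, whence
-- 159 = 145 + 14.
linear-bound : ∀ n m → 1 ≤ m + n → 14 + 62 * n + 145 * m ≤ 159 * (m + n)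
linear-bound n m 1≤ = begin
  14 + 62 * n + 145 * m               ≤⟨ m≤m+n _ (83 * n) ⟩
  14 + 62 * n + 145 * m + 83 * n      ≡⟨ arith n m ⟩
  14 * 1 + 145 * (m + n)              ≤⟨ +-monoˡ-≤ (145 * (m + n)) (*-monoʳ-≤ 14 1≤) ⟩
  14 * (m + n) + 145 * (m + n)        ≡⟨ *-distribʳ-+ (m + n) 14 145 ⟨
  159 * (m + n)                       ∎
  where
  open ≤-Reasoning
  arith : ∀ n m → 14 + 62 * n + 145 * m + 83 * n ≡ 14 * 1 + 145 * (m + n)
  arith = solve-∀

mainTheorem5 : ∃[ P ] ∃[ k ] ∃[ c ] ∃[ N₀ ] ((G : Graph) (σ : Ordering G) →
    ∃[ π ] ∃[ t ]
    IsStarOrder G σ π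
    × HaltsWith P (wordBound k G) (encodeInput G σ) t (encodeEdges π)
    × (N₀ ≤ m G + n G → t ≤ c * (m G + n G)))
-- The threshold 1 excludes just the graph without vertices, where the linear bound is 0 although
-- the program still takes its constant number of steps.
mainTheorem5 = program , 6 , 159 , 1 , λ G σ →
  let open Sorting G σ
      open Correctness G σ (wordBound 6 G) (capacity-bound G)
      π , bijective , ordered , encoded =
        enumerate-starOrder sortedPairs sortedPairs-sorted
          ∈-sortedPairs⁺ ∈-sortedPairs⁻ length-sortedPairs
      t , t≤ , halts = starSort-halts
  in π , t , record { bijective = bijective ; ordered = ordered }
   , subst (HaltsWith program (wordBound 6 G) (encodeInput G σ) t) (sym encoded) halts
   , λ 1≤ → ≤-trans t≤ (linear-bound (n G) (m G) 1≤)
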